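{- Let $F$ be a simple graph of order $n\ge2$, let $E_k=\{e_1,\ldots,e_k\}\subseteq E(F)$ with $|E_k|=k$, and suppose the subgraph $\mathscr E_k$ of $F$ induced by $E_k$ is $r$-regular. Let $H_{uv}$ and $H_{xy}$ be two disjoint simple graphs of order $m$ with specified edges $uv$ and $xy$ respectively, where $u,v$ have degree $m-1$ in $H_{uv}$ and $x,y$ have degree $m-1$ in $H_{xy}$, such that $H_{uv}-\{u,v\}$ and $H_{xy}-\{x,y\}$ are $r_2$-regular, where $m\ge3$ and $r_2\ge2$. If $H_{uv}$ and $H_{xy}$ are $Q$-cospectral, then $G[F,E_k,H_{uv}]$ and $G[F,E_k,H_{xy}]$ are $Q$-cospectral.
   Context: All graphs are finite and simple. $Q(X)=D(X)+A(X)$ is the signless Laplacian matrix of a graph $X$ ($D$ the diagonal degree matrix, $A$ the adjacency matrix). Two graphs are $Q$-cospectral if their signless Laplacian matrices have the same spectrum (with multiplicities). The subgraph induced by an edge set $E_k$ has edge set $E_k$ and vertex set the endpoints of edges in $E_k$. Graph with $k$ edge-pockets: $H_{uv}$ is a graph with a specified edge $uv$ such that $H_{uv}-u\cong H_{uv}-v$ (automatic when $u,v$ both have degree $m-1$). $G[F,E_k,H_{uv}]$ is obtained by taking one copy of $F$ and $k$ vertex-disjoint copies of $H_{uv}$, and, for each $i=1,\ldots,k$, pasting (identifying) the edge $uv$ of the $i$th copy of $H_{uv}$ with the edge $e_i$ of $F$; likewise for $H_{xy}$ with its edge $xy$. -}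

module Defs where

open import Level using (Level; _⊔_; suc)
open import Algebra.Bundles using (CommutativeRing; RawRing)
open import Algebra.Apartness.Bundles using (HeytingField; HeytingCommutativeRing)
import Algebra.Definitions.RawSemiring as RawSemiringDefs
open import Data.Bool.Base using (Bool; true; false; _∧_; _∨_; if_then_else_)
open import Data.Bool.Properties using (∧-zeroʳ)
open import Data.Fin.Base using (Fin; zero; toℕ; punchIn; punchOut; splitAt; remQuot)
import Data.Fin.Base as Fin
open import Data.Fin.Properties using (_≟_)
open import Data.Fin.Subset using (Subset; ∣_∣)
open import Data.List.Base using (List; []; _∷_; _++_; map; foldr)
open import Data.Nat.Base as ℕ using (ℕ; zero; _∸_)
open import Data.Product.Base using (∃-syntax; _×_; _,_)
open import Data.Sum.Base using (_⊎_; inj₁; inj₂; map₂)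
open import Data.Vec.Base using (tabulate)
open import Function.Base using (_∘_)
open import Relation.Binary.PropositionalEquality
  using (_≡_; _≢_; refl; sym; trans; cong₂)
open import Relation.Nullary.Decidable using (does; yes; no)
open import Relation.Nullary.Negation using (contradiction)

private
  variable
    c ℓ ℓ₁ ℓ₂ : Level
    A : Set c
    n m k : ℕ

------------------------------------------------------------------------
-- Graphs

record Graph (n : ℕ) : Set where
  field
    adj        : Fin n → Fin n → Bool
    adj-sym    : ∀ p q → adj p q ≡ adj q p
    adj-irrefl : ∀ p → adj p p ≡ false

open Graph public

degree : Graph n → Fin n → ℕ
degree G p = ∣ tabulate (adj G p) ∣

Regular : Graph n → ℕ → Set
Regular G r = ∀ p → degree G p ≡ r

-- An edge together with a choice of orientation; `_≈ᵉ_` forgets the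
-- orientation.
record Edge (G : Graph n) : Set where
  field
    src    : Fin n
    tgt    : Fin n
    isEdge : adj G src tgt ≡ true

open Edge public

_≈ᵉ_ : {G : Graph n} → Edge G → Edge G → Set
e ≈ᵉ e′ = (src e ≡ src e′ × tgt e ≡ tgt e′)
        ⊎ (src e ≡ tgt e′ × tgt e ≡ src e′)

src≢tgt : {G : Graph n} (e : Edge G) → src e ≢ tgt e
src≢tgt {G = G} record { src = p ; tgt = .p ; isEdge = p~p } refl
  with () ← trans (sym p~p) (adj-irrefl G p)

Incident : {G : Graph n} → Fin n → Edge G → Set
Incident p e = p ≡ src e ⊎ p ≡ tgt e

incidentEdges : {G : Graph n} → (Fin k → Edge G) → Fin n → Subset k
incidentEdges E p =
  tabulate λ i → does (p ≟ src (E i)) ∨ does (p ≟ tgt (E i))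

-- The vertices of the subgraph induced by an edge set are exactly the
-- endpoints of its edges.  When `E` enumerates the edge set without
-- repetition, the degree of such a vertex in that subgraph is the number of
-- indices i for which it is an endpoint of `E i`.
EdgeInducedRegular : {G : Graph n} → (Fin k → Edge G) → ℕ → Set
EdgeInducedRegular E r =
  ∀ p → (∃[ i ] Incident p (E i)) → ∣ incidentEdges E p ∣ ≡ r

-- The increasing enumeration of the vertices other than p and q.
others : (p q : Fin n) → p ≢ q → Fin (n ∸ 2) → Fin n
others {ℕ.suc (ℕ.suc _)} p q p≢q w = punchIn p (punchIn (punchOut p≢q) w)

interior : {H : Graph m} → Edge H → Fin (m ∸ 2) → Fin m
interior e = others (src e) (tgt e) (src≢tgt e)

-- H − {u, v} for an edge uv of H.
removeEnds : {H : Graph m} → Edge H → Graph (m ∸ 2)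
removeEnds {H = H} e = record
  { adj        = λ w w′ → adj H (interior e w) (interior e w′)
  ; adj-sym    = λ w w′ → adj-sym H (interior e w) (interior e w′)
  ; adj-irrefl = λ w → adj-irrefl H (interior e w)
  }

-- G[F, E_k, H_uv].  Pasting the edge uv of the i-th copy of H onto E i
-- identifies u with src (E i) and v with tgt (E i), so the vertices are those
-- of F together with k copies of the vertices of H other than u and v.
module Pocket {F : Graph n} (E : Fin k → Edge F) {H : Graph m} (uv : Edge H) where

  Vertex : Set
  Vertex = Fin n ⊎ (Fin k × Fin (m ∸ 2))

  vertex : Fin (n ℕ.+ k ℕ.* (m ∸ 2)) → Vertex
  vertex = map₂ (remQuot (m ∸ 2)) ∘ splitAt n

  attached : Fin n → Fin k → Fin (m ∸ 2) → Bool
  attached p i w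
    = (does (p ≟ src (E i)) ∧ adj H (src uv) (interior uv w))
    ∨ (does (p ≟ tgt (E i)) ∧ adj H (tgt uv) (interior uv w))

  adjV : Vertex → Vertex → Bool
  adjV (inj₁ p)       (inj₁ q)        = adj F p q
  adjV (inj₁ p)       (inj₂ (i , w))  = attached p i w
  adjV (inj₂ (i , w)) (inj₁ p)        = attached p i w
  adjV (inj₂ (i , w)) (inj₂ (j , w′)) = does (i ≟ j) ∧ adj (removeEnds uv) w w′

  does-≟-sym : (i j : Fin k) → does (i ≟ j) ≡ does (j ≟ i)
  does-≟-sym i j with i ≟ j | j ≟ i
  ... | yes _   | yes _   = refl
  ... | no  _   | no  _   = refl
  ... | yes i≡j | no  j≢i = contradiction (sym i≡j) j≢i
  ... | no  i≢j | yes j≡i = contradiction (sym j≡i) i≢j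

  adjV-sym : ∀ x y → adjV x y ≡ adjV y x
  adjV-sym (inj₁ p)       (inj₁ q)        = adj-sym F p q
  adjV-sym (inj₁ p)       (inj₂ (i , w))  = refl
  adjV-sym (inj₂ (i , w)) (inj₁ p)        = refl
  adjV-sym (inj₂ (i , w)) (inj₂ (j , w′)) =
    cong₂ _∧_ (does-≟-sym i j) (adj-sym (removeEnds uv) w w′)

  adjV-irrefl : ∀ x → adjV x x ≡ false
  adjV-irrefl (inj₁ p)       = adj-irrefl F p
  adjV-irrefl (inj₂ (i , w)) =
    trans (cong₂ _∧_ {x = does (i ≟ i)} refl (adj-irrefl (removeEnds uv) w))
          (∧-zeroʳ (does (i ≟ i)))

pocketGraph : {F : Graph n} → (Fin k → Edge F) → {H : Graph m} → Edge H →
              Graph (n ℕ.+ k ℕ.* (m ∸ 2))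
pocketGraph E uv = record
  { adj        = λ x y → adjV (vertex x) (vertex y)
  ; adj-sym    = λ x y → adjV-sym (vertex x) (vertex y)
  ; adj-irrefl = λ x → adjV-irrefl (vertex x)
  }
  where open Pocket E uv

------------------------------------------------------------------------
-- Matrices and polynomials

Matrix : Set c → ℕ → Set c
Matrix A n = Fin n → Fin n → A

diagonal : A → (Fin n → A) → Matrix A n
diagonal 0# d i j = if does (i ≟ j) then d i else 0#

module Determinant (R : RawRing c ℓ) where
  open RawRing R
  open RawSemiringDefs rawSemiring using (sum; _^_)

  minor : Matrix Carrier (ℕ.suc n) → Fin (ℕ.suc n) → Matrix Carrier n
  minor M j p q = M (Fin.suc p) (punchIn j q)

  -- Laplace expansion along the first row.
  det : Matrix Carrier n → Carrier
  det {zero}    M = 1#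
  det {ℕ.suc n} M = sum λ j → (- 1#) ^ toℕ j * (M zero j * det (minor M j))

-- Polynomials are lists of coefficients, constant term first; trailing
-- zeros are allowed.
module Polynomial (R : RawRing c ℓ) where
  open RawRing R

  Poly : Set c
  Poly = List Carrier

  coeff : Poly → ℕ → Carrier
  coeff []      _         = 0#
  coeff (a ∷ p) zero      = a
  coeff (a ∷ p) (ℕ.suc i) = coeff p i

  infixl 6 _+ᴾ_
  infixl 7 _*ᴾ_

  _+ᴾ_ : Poly → Poly → Poly
  []      +ᴾ q       = q
  (a ∷ p) +ᴾ []      = a ∷ p
  (a ∷ p) +ᴾ (b ∷ q) = (a + b) ∷ (p +ᴾ q)

  _*ᴾ_ : Poly → Poly → Poly
  []      *ᴾ q = []
  (a ∷ p) *ᴾ q = map (a *_) q +ᴾ (0# ∷ (p *ᴾ q))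

  constant : Carrier → Poly
  constant a = a ∷ []

  X : Poly
  X = 0# ∷ 1# ∷ []

  polyRing : RawRing c ℓ
  polyRing = record
    { Carrier = Poly
    ; _≈_     = λ p q → ∀ i → coeff p i ≈ coeff q i
    ; _+_     = _+ᴾ_
    ; _*_     = _*ᴾ_
    ; -_      = map (-_)
    ; 0#      = []
    ; 1#      = constant 1#
    }

  evaluate : Poly → Carrier → Carrier
  evaluate p x = foldr (λ a y → a + x * y) 0# p

------------------------------------------------------------------------
-- Spectra

-- Eigenvalues are taken in an arbitrary algebraically closed field of
-- characteristic zero, such as the complex numbers.
record AlgebraicallyClosedField c ℓ₁ ℓ₂ : Set (suc (c ⊔ ℓ₁ ⊔ ℓ₂)) where
  field
    heytingField : HeytingField c ℓ₁ ℓ₂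

  open HeytingField heytingField public
    using (Carrier; _≈_; _#_; 0#; 1#; heytingCommutativeRing)

  commutativeRing : CommutativeRing c ℓ₁
  commutativeRing = HeytingCommutativeRing.commutativeRing heytingCommutativeRing

  rawRing : RawRing c ℓ₁
  rawRing = CommutativeRing.rawRing commutativeRing

  open RawSemiringDefs (RawRing.rawSemiring rawRing)
    using () renaming (_×_ to _×ᴷ_) public
  open Polynomial rawRing using (evaluate)

  field
    characteristicZero : ∀ d → (ℕ.suc d ×ᴷ 1#) # 0#
    -- The polynomials a ∷ p ++ 1# ∷ [] are the monic ones of positive degree.
    root : ∀ a p → ∃[ x ] evaluate (a ∷ p ++ 1# ∷ []) x ≈ 0#

-- The entries of D(G) + A(G) are natural numbers.
signlessLaplacian : Graph n → Matrix ℕ n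
signlessLaplacian G i j = D i j ℕ.+ A′ i j
  where
  D A′ : Matrix ℕ _
  D      = diagonal 0 (degree G)
  A′ p q = if adj G p q then 1 else 0

module Spectrum (K : AlgebraicallyClosedField c ℓ₁ ℓ₂) where
  open AlgebraicallyClosedField K
  open Polynomial rawRing
  open RawRing polyRing using (_+_; -_) renaming (_≈_ to _≈ᴾ_; 1# to 1ᴾ)

  charpoly : Matrix Carrier n → Poly
  charpoly M = Determinant.det polyRing
    λ i j → diagonal [] (λ _ → X) i j + (- constant (M i j))

  -- The list s contains the eigenvalues of M, each repeated according to its
  -- multiplicity; its order is immaterial.
  IsSpectrum : Matrix Carrier n → List Carrier → Set ℓ₁
  IsSpectrum M s =
    charpoly M ≈ᴾ foldr (λ a p → (X + (- constant a)) *ᴾ p) 1ᴾ s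

  Q : Graph n → Matrix Carrier n
  Q G i j = signlessLaplacian G i j ×ᴷ 1#

  QCospectral : Graph n → Graph m → Set (c ⊔ ℓ₁)
  QCospectral G G′ = ∃[ s ] IsSpectrum (Q G) s × IsSpectrum (Q G′) s

{-# OPTIONS --safe #-}

-- Order the vertices of a pasted graph with those of F first.  Every column of
-- the block Y of X − Q(H) on the interior of H sums to t = X − (2 + 2 r₂), and
-- every interior vertex is joined to both ends, so adding rows of the interior
-- to t times a row of F clears the block between F and the interior.  With L
-- the matrix of these row operations,
--   det L · φ(G[F, E_k, H]) = det S · det (t I) · (det Y)ᵏ,
-- where L and S depend on F, E_k, m and r₂ but not otherwise on H.  Likewise
-- φ(H) satisfies such an equation with k = 1 and the ends of H in place of F.
-- The factors det L, det (t I) and, for H, also det S are monic, hence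
-- cancellable, so φ(H) determines det Y, which determines φ(G).  A list of
-- eigenvalues of G is then obtained by splitting the monic polynomial φ(G).

module Submission where

open import Defs
open import Algebra.Bundles using (CommutativeMonoid; CommutativeRing; RawRing)
import Algebra.Definitions.RawSemiring as RawSemiringDefs
import Algebra.Properties.CommutativeMonoid.Sum as CommutativeMonoidSum
import Algebra.Properties.Group as GroupProperties
import Algebra.Properties.Monoid.Mult as MonoidMult
import Algebra.Properties.Ring as RingProperties
import Algebra.Properties.Semiring.Exp as SemiringExp
import Algebra.Properties.Semiring.Sum as SemiringSum
import Algebra.Solver.Ring.NaturalCoefficients.Default as NatSolver
open import Data.Bool.Base using (Bool; true; false; if_then_else_; not; _∧_; _∨_)
open import Data.Bool.Properties using (∧-identityʳ)
open import Data.Fin.Base using (Fin; zero; suc; toℕ; punchIn; punchOut; lift; splitAt; join; _↑ˡ_; _↑ʳ_; remQuot; combine)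
open import Data.Fin.Permutation using (Permutation; _⟨$⟩ʳ_; _⟨$⟩ˡ_; inverseˡ; inverseʳ; insert) renaming (id to idₚ)
open import Data.Fin.Properties
  using (_≟_; suc-injective; punchInᵢ≢i; punchIn-punchOut; punchIn-injective; ↑ˡ-injective; ↑ʳ-injective;
         splitAt-↑ˡ; splitAt⁻¹-↑ˡ; splitAt-join; join-splitAt; combine-remQuot)
open import Data.Fin.Subset using (∣_∣)
open import Data.List.Base using (List; []; _∷_; _++_; map; foldr; length; applyUpTo)
open import Data.List.Properties using (length-applyUpTo)
open import Data.Nat.Base as ℕ using (ℕ; zero; suc; _≤_; _<_; _∸_; z≤n; s≤s; z<s; s<s⁻¹)
import Data.Nat.Properties as ℕ
open import Data.Product.Base using (∃-syntax; _×_; _,_; proj₁; proj₂) renaming (map₁ to map₁ᴾ)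
open import Data.Sum.Base using (_⊎_; inj₁; inj₂; map₁; map₂)
open import Data.Vec.Base using (tabulate)
open import Data.Vec.Functional using (tail; insertAt; updateAt) renaming (_∷_ to _◂_)
open import Data.Vec.Functional.Properties using (updateAt-updates; updateAt-minimal; insertAt-lookup; insertAt-punchIn)
open import Function.Base using (_∘_; const)
open import Function.Definitions using (Injective)
open import Level using (_⊔_)
open import Relation.Binary.PropositionalEquality as ≡ using (_≡_; _≢_)
import Relation.Binary.Reasoning.Setoid as SetoidReasoning
open import Relation.Nullary.Decidable using (does; yes; no)
open import Relation.Nullary.Negation using (contradiction)

-- A Schur complement would use the inverse of `Y`, which does not exist over polynomials. Its
-- effect on constant rows is known all the same: the all-ones row is a left eigenvector of `Y` with
-- eigenvalue t, so multiplying by t does the work of inverting `Y`. The eigenvalue collects the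
-- diagonal entry X - (2 + r₂), as an interior vertex sees both ends and r₂ interior neighbours, and
-- the r₂ entries -1 of the same column. Pasting leaves the degree of an interior vertex as it was
-- in H, so one and the same `Y` occurs in both identities.
--
-- The obstacle is cancellation. Equality in the field is not assumed decidable, so the leading
-- nonzero coefficient of an arbitrary polynomial cannot be singled out. Monic polynomials are
-- cancellable nevertheless, and a determinant is monic as soon as its diagonal entries are monic of
-- degree d + 1 and all others have degree at most d. The elimination is arranged so that every
-- factor to be cancelled has this shape; det S of the pasted graph is common to both sides and
-- stays in place.

diagonal-≡ : ∀ {a} {A : Set a} {n} {z : A} (d : Fin n → A) i → diagonal z d i i ≡ d i
diagonal-≡ d i with i ≟ i
... | yes _   = ≡.refl
... | no  i≢i = contradiction ≡.refl i≢i

diagonal-≢ : ∀ {a} {A : Set a} {n} {z : A} (d : Fin n → A) {i j} → i ≢ j → diagonal z d i j ≡ z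
diagonal-≢ d {i} {j} i≢j with i ≟ j
... | yes i≡j = contradiction i≡j i≢j
... | no  _   = ≡.refl

diagonal-restrict : ∀ {a} {A : Set a} {n m} {z : A} (d : Fin m → A) (d′ : Fin n → A) (f : Fin n → Fin m) →
                    (∀ {i j} → f i ≡ f j → i ≡ j) → (∀ i → d (f i) ≡ d′ i) →
                    ∀ i j → diagonal z d (f i) (f j) ≡ diagonal z d′ i j
diagonal-restrict d d′ f f-injective d≡d′ i j with i ≟ j
... | yes ≡.refl = ≡.trans (diagonal-≡ d (f i)) (d≡d′ i)
... | no  i≢j    = diagonal-≢ d (i≢j ∘ f-injective)

-- Names the case analysis hidden in `remQuot` at `suc k`, so that inductions on the number of
-- copies can peel off the first block of length `l`.
fromSplit : ∀ {k} l → Fin l ⊎ Fin (k ℕ.* l) → Fin (suc k) × Fin l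
fromSplit l (inj₁ w) = zero , w
fromSplit l (inj₂ x) = map₁ᴾ suc (remQuot l x)

remQuot-suc : ∀ {k l} (x : Fin (suc k ℕ.* l)) → remQuot {suc k} l x ≡ fromSplit l (splitAt l x)
remQuot-suc {k} {l} x with splitAt l x
... | inj₁ _ = ≡.refl
... | inj₂ _ = ≡.refl

-- Finite sums over disjoint unions and products of index sets

module SumProperties {c ℓ} (M : CommutativeMonoid c ℓ) where
  open CommutativeMonoid M
  open CommutativeMonoidSum M
  open SetoidReasoning setoid

  sum-ε : ∀ {n} {t : Fin n → Carrier} → (∀ i → t i ≈ ε) → sum t ≈ ε
  sum-ε {n} t≈ε = trans (sum-cong-≋ t≈ε) (sum-replicate-zero n)

  sum-⊎ : ∀ a {b} (t : Fin a ⊎ Fin b → Carrier) →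
          sum (λ x → t (splitAt a x)) ≈ sum (t ∘ inj₁) ∙ sum (t ∘ inj₂)
  sum-⊎ zero    t = sym (identityˡ _)
  sum-⊎ (suc a) t = trans (∙-congˡ (sum-⊎ a (t ∘ map₁ suc))) (sym (assoc _ _ _))

  sum-× : ∀ k l (t : Fin k × Fin l → Carrier) →
          sum (λ x → t (remQuot {k} l x)) ≈ sum (λ i → sum (λ w → t (i , w)))
  sum-× zero    l t = refl
  sum-× (suc k) l t = begin
    sum (λ x → t (remQuot {suc k} l x))              ≡⟨ sum-cong-≗ (λ x → ≡.cong t (remQuot-suc x)) ⟩
    sum (λ x → t (fromSplit {k} l (splitAt l x)))    ≈⟨ sum-⊎ l (t ∘ fromSplit {k} l) ⟩
    sum (λ w → t (zero , w)) ∙ sum (λ x → t (map₁ᴾ suc (remQuot {k} l x)))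
                                                     ≈⟨ ∙-congˡ (sum-× k l (t ∘ map₁ᴾ suc)) ⟩
    sum (λ w → t (zero , w)) ∙ sum (λ i → sum (λ w → t (suc i , w))) ∎

  sum-single : ∀ {n} (t : Fin n → Carrier) i → sum (λ j → if does (j ≟ i) then t j else ε) ≈ t i
  sum-single {suc n} t zero    = trans (∙-congˡ (sum-replicate-zero n)) (identityʳ _)
  sum-single t (suc i) = trans (identityˡ _) (sum-single (t ∘ suc) i)

  sum-single′ : ∀ {n} (t : Fin n → Carrier) i → sum (λ j → if does (i ≟ j) then t j else ε) ≈ t i
  sum-single′ {suc n} t zero    = trans (∙-congˡ (sum-replicate-zero n)) (identityʳ _)
  sum-single′ t (suc i) = trans (identityˡ _) (sum-single′ (t ∘ suc) i)

-- Determinants over a commutative ring: multilinearity and alternation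

module DeterminantProperties {c ℓ} (R : CommutativeRing c ℓ) where
  open CommutativeRing R hiding (zero)
  open RingProperties ring using (-‿involutive; -1*x≈-x; -0#≈0#; +-inverseˡ-unique)
  open Determinant rawRing
  open RawSemiringDefs (RawRing.rawSemiring rawRing) using (_^_)
  open SemiringSum semiring
  open SumProperties +-commutativeMonoid using (sum-ε; sum-⊎)
  open NatSolver commutativeSemiring using (solve; _:=_; _:+_; _:*_; con)
  open SetoidReasoning setoid

  Rows : ℕ → ℕ → Set c
  Rows n N = Fin n → Fin N → Carrier

  -- Additivity and homogeneity form one axiom. It speaks of any three matrices that agree off row
  -- `i` instead of a row-update operation, which spares rewriting matrices into the form of an
  -- update.
  record Multilinear {n N} (f : Rows n N → Carrier) : Set (c ⊔ ℓ) where
    field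
      cong   : ∀ {M M′} → (∀ p q → M p q ≈ M′ p q) → f M ≈ f M′
      linear : ∀ i a {M M′ P} →
               (∀ p → p ≢ i → ∀ q → P p q ≈ M p q) →
               (∀ p → p ≢ i → ∀ q → P p q ≈ M′ p q) →
               (∀ q → P i q ≈ a * M i q + M′ i q) →
               f P ≈ a * f M + f M′

  -- Kept for a single pair of rows: the proof that `det` alternates already needs `swap` for one
  -- pair, before the property is known for all of them.
  VanishesOn : ∀ {n N} (f : Rows n N → Carrier) → Fin n → Fin n → Set (c ⊔ ℓ)
  VanishesOn f i j = ∀ M → (∀ q → M i q ≈ M j q) → f M ≈ 0#

  record Alternating {n N} (f : Rows n N → Carrier) : Set (c ⊔ ℓ) where
    field
      multilinear : Multilinear f
      alternate   : ∀ {i j} → i ≢ j → VanishesOn f i j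
    open Multilinear multilinear public

  -1*x+x≈0 : ∀ x → - 1# * x + x ≈ 0#
  -1*x+x≈0 x = trans (+-congʳ (-1*x≈-x x)) (-‿inverseˡ x)

  module _ {n N} {f : Rows n N → Carrier} (f-multilinear : Multilinear f) where
    open Multilinear f-multilinear

    -- A zero row equals `- 1#` times itself plus itself, so linearity applies with all three
    -- matrices equal to `M`.
    zero-row : ∀ {M} i → (∀ q → M i q ≈ 0#) → f M ≈ 0#
    zero-row {M} i Mi≈0 = begin
      f M                ≈⟨ linear i (- 1#) (λ _ _ _ → refl) (λ _ _ _ → refl)
                              (λ q → trans (Mi≈0 q) (sym (-1*x+x≈0 (M i q)))) ⟩
      - 1# * f M + f M   ≈⟨ -1*x+x≈0 (f M) ⟩
      0#                 ∎

    -- Expand f on the rows x + y, x + y in the positions i and j.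
    swap : ∀ {i j} → VanishesOn f i j → i ≢ j → ∀ {M M′} →
           (∀ q → M′ i q ≈ M j q) → (∀ q → M′ j q ≈ M i q) →
           (∀ p → p ≢ i → p ≢ j → ∀ q → M′ p q ≈ M p q) →
           f M′ ≈ - f M
    swap {i} {j} vanishes i≢j {M} {M′} M′i M′j M′p = begin
      f M′       ≈⟨ f-cong-place M′i M′j M′p ⟩
      T y x      ≈⟨ +-inverseˡ-unique _ _ (trans (+-comm _ _) T+T) ⟩
      - T x y    ≈⟨ -‿cong (f-cong-place (λ _ → refl) (λ _ → refl) (λ _ _ _ _ → refl)) ⟨
      - f M      ∎
      where
      Row = Fin N → Carrier
      x y x+y : Row
      x = M i
      y = M j
      x+y q = x q + y q

      place : Row → Row → Rows n N
      place a b = updateAt (updateAt M i (const a)) j (const b)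

      place-i : ∀ a b q → place a b i q ≡ a q
      place-i a b q = ≡.cong (λ r → r q)
        (≡.trans (updateAt-minimal i j _ i≢j) (updateAt-updates i M))

      place-j : ∀ a b q → place a b j q ≡ b q
      place-j a b q = ≡.cong (λ r → r q) (updateAt-updates j (updateAt M i (const a)))

      place-p : ∀ a b p → p ≢ i → p ≢ j → ∀ q → place a b p q ≡ M p q
      place-p a b p p≢i p≢j q = ≡.cong (λ r → r q)
        (≡.trans (updateAt-minimal p j _ p≢j) (updateAt-minimal p i M p≢i))

      T : Row → Row → Carrier
      T a b = f (place a b)

      f-cong-place : ∀ {P a b} → (∀ q → P i q ≈ a q) → (∀ q → P j q ≈ b q) →
                     (∀ p → p ≢ i → p ≢ j → ∀ q → P p q ≈ M p q) → f P ≈ T a b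
      f-cong-place {P} {a} {b} Pi Pj Pp = cong eq
        where
        eq : ∀ p q → P p q ≈ place a b p q
        eq p q with p ≟ i | p ≟ j
        ... | yes ≡.refl | _          = trans (Pi q) (reflexive (≡.sym (place-i a b q)))
        ... | no _       | yes ≡.refl = trans (Pj q) (reflexive (≡.sym (place-j a b q)))
        ... | no p≢i     | no p≢j     = trans (Pp p p≢i p≢j q) (reflexive (≡.sym (place-p a b p p≢i p≢j q)))

      T-same : ∀ a → T a a ≈ 0#
      T-same a = vanishes (place a a) λ q → reflexive (≡.trans (place-i a a q) (≡.sym (place-j a a q)))

      i-free : ∀ a a′ b p → p ≢ i → ∀ q → place a b p q ≈ place a′ b p q
      i-free a a′ b p p≢i q with p ≟ j
      ... | yes ≡.refl = reflexive (≡.trans (place-j a b q) (≡.sym (place-j a′ b q)))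
      ... | no  p≢j    = reflexive (≡.trans (place-p a b p p≢i p≢j q) (≡.sym (place-p a′ b p p≢i p≢j q)))

      j-free : ∀ a b b′ p → p ≢ j → ∀ q → place a b p q ≈ place a b′ p q
      j-free a b b′ p p≢j q with p ≟ i
      ... | yes ≡.refl = reflexive (≡.trans (place-i a b q) (≡.sym (place-i a b′ q)))
      ... | no  p≢i    = reflexive (≡.trans (place-p a b p p≢i p≢j q) (≡.sym (place-p a b′ p p≢i p≢j q)))

      T-+ˡ : ∀ b → T x+y b ≈ 1# * T x b + T y b
      T-+ˡ b = linear i 1# (i-free x+y x b) (i-free x+y y b) λ q → begin
        place x+y b i q                      ≡⟨ place-i x+y b q ⟩
        x q + y q                            ≈⟨ +-congʳ (*-identityˡ (x q)) ⟨
        1# * x q + y q                       ≡⟨ ≡.cong₂ (λ u v → 1# * u + v) (place-i x b q) (place-i y b q) ⟨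
        1# * place x b i q + place y b i q   ∎

      T-+ʳ : ∀ a → T a x+y ≈ 1# * T a x + T a y
      T-+ʳ a = linear j 1# (j-free a x+y x) (j-free a x+y y) λ q → begin
        place a x+y j q                      ≡⟨ place-j a x+y q ⟩
        x q + y q                            ≈⟨ +-congʳ (*-identityˡ (x q)) ⟨
        1# * x q + y q                       ≡⟨ ≡.cong₂ (λ u v → 1# * u + v) (place-j a x q) (place-j a y q) ⟨
        1# * place a x j q + place a y j q   ∎

      T+T : T x y + T y x ≈ 0#
      T+T = begin
        T x y + T y x
          ≈⟨ solve 2 (λ u v → u :+ v := (con 1 :* (con 1 :* con 0 :+ u)) :+ (con 1 :* v :+ con 0)) refl _ _ ⟩
        1# * (1# * 0# + T x y) + (1# * T y x + 0#)
          ≈⟨ +-cong (*-congˡ (+-congʳ (*-congˡ (T-same x)))) (+-congˡ (T-same y)) ⟨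
        1# * (1# * T x x + T x y) + (1# * T y x + T y y)
          ≈⟨ +-cong (*-congˡ (T-+ʳ x)) (T-+ʳ y) ⟨
        1# * T x x+y + T y x+y
          ≈⟨ T-+ˡ x+y ⟨
        T x+y x+y
          ≈⟨ T-same x+y ⟩
        0# ∎

  sign : ∀ {n} → Fin n → Carrier
  sign j = (- 1#) ^ toℕ j

  det-cong : ∀ {n} {M M′ : Matrix Carrier n} → (∀ p q → M p q ≈ M′ p q) → det M ≈ det M′
  det-cong {zero}  M≈M′ = refl
  det-cong {suc n} M≈M′ = sum-cong-≋ λ j →
    *-congˡ {sign j} (*-cong (M≈M′ zero j) (det-cong λ p q → M≈M′ (suc p) (punchIn j q)))

  det-multilinear : ∀ {n} → Multilinear (det {n})
  det-multilinear {n} = record { cong = det-cong ; linear = lin n }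
    where
    lin : ∀ n i a {M M′ P : Matrix Carrier n} →
          (∀ p → p ≢ i → ∀ q → P p q ≈ M p q) →
          (∀ p → p ≢ i → ∀ q → P p q ≈ M′ p q) →
          (∀ q → P i q ≈ a * M i q + M′ i q) →
          det P ≈ a * det M + det M′
    lin (suc n) i a {M} {M′} {P} P≈M P≈M′ Pi = begin
      det P                                        ≈⟨ sum-cong-≋ (λ j → term i j P≈M P≈M′ Pi) ⟩
      sum (λ j → a * summand M j + summand M′ j)   ≈⟨ ∑-distrib-+ (λ j → a * summand M j) (summand M′) ⟩
      sum (λ j → a * summand M j) + det M′         ≈⟨ +-congʳ (*-distribˡ-sum a (summand M)) ⟨
      a * det M + det M′                           ∎
      where
      summand : Matrix Carrier (suc n) → Fin (suc n) → Carrier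
      summand M j = sign j * (M zero j * det (minor M j))

      term : ∀ i j → (∀ p → p ≢ i → ∀ q → P p q ≈ M p q) →
             (∀ p → p ≢ i → ∀ q → P p q ≈ M′ p q) →
             (∀ q → P i q ≈ a * M i q + M′ i q) →
             summand P j ≈ a * summand M j + summand M′ j
      term zero j P≈M P≈M′ Pi = begin
        sign j * (P zero j * det (minor P j))
          ≈⟨ *-congˡ (*-congʳ (Pi j)) ⟩
        sign j * ((a * M zero j + M′ zero j) * det (minor P j))
          ≈⟨ solve 5 (λ s a x y d → s :* ((a :* x :+ y) :* d) := a :* (s :* (x :* d)) :+ s :* (y :* d)) refl _ _ _ _ _ ⟩
        a * (sign j * (M zero j * det (minor P j))) + sign j * (M′ zero j * det (minor P j))
          ≈⟨ +-cong (*-congˡ (*-congˡ (*-congˡ (det-cong λ p q → P≈M (suc p) (λ ()) _))))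
                    (*-congˡ (*-congˡ (det-cong λ p q → P≈M′ (suc p) (λ ()) _))) ⟩
        a * summand M j + summand M′ j ∎
      term (suc i) j P≈M P≈M′ Pi = begin
        sign j * (P zero j * det (minor P j))
          ≈⟨ *-congˡ (*-congˡ (lin n i a
               (λ p p≢i q → P≈M (suc p) (p≢i ∘ suc-injective) (punchIn j q))
               (λ p p≢i q → P≈M′ (suc p) (p≢i ∘ suc-injective) (punchIn j q))
               (λ q → Pi (punchIn j q)))) ⟩
        sign j * (P zero j * (a * det (minor M j) + det (minor M′ j)))
          ≈⟨ solve 5 (λ s z a x y → s :* (z :* (a :* x :+ y)) := a :* (s :* (z :* x)) :+ s :* (z :* y)) refl _ _ _ _ _ ⟩
        a * (sign j * (P zero j * det (minor M j))) + sign j * (P zero j * det (minor M′ j))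
          ≈⟨ +-cong (*-congˡ (*-congˡ (*-congʳ (P≈M zero (λ ()) j))))
                    (*-congˡ (*-congʳ (P≈M′ zero (λ ()) j))) ⟩
        a * summand M j + summand M′ j ∎

  -- The terms of the expansion along two equal rows a cancel in pairs: the
  -- columns {p, q} are removed in either order, with opposite signs.
  pairs-cancel : ∀ n (a : Fin (2 ℕ.+ n) → Carrier) (D : (Fin n → Fin (2 ℕ.+ n)) → Carrier) →
    (∀ {σ τ} → (∀ i → σ i ≡ τ i) → D σ ≈ D τ) →
    sum (λ j → sign j * (a j * sum (λ k → sign k * (a (punchIn j k) * D (punchIn j ∘ punchIn k))))) ≈ 0#
  pairs-cancel n a D D-cong = begin
    1# * (a zero * sum u) + sum (λ j → (- 1# * sign j) * (a (suc j) * (1# * (a zero * D (punchIn (suc j) ∘ suc)) + v j)))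
      ≈⟨ +-cong (trans (*-identityˡ _) (*-distribˡ-sum (a zero) u)) (sum-cong-≋ split) ⟩
    sum (λ k → a zero * u k) + sum (λ j → - 1# * (a zero * u j) + - 1# * w j)
      ≈⟨ +-congˡ (∑-distrib-+ (λ j → - 1# * (a zero * u j)) (λ j → - 1# * w j)) ⟩
    sum (λ k → a zero * u k) + (sum (λ j → - 1# * (a zero * u j)) + sum (λ j → - 1# * w j))
      ≈⟨ +-congˡ (+-cong (*-distribˡ-sum (- 1#) (λ k → a zero * u k)) (*-distribˡ-sum (- 1#) w)) ⟨
    sum (λ k → a zero * u k) + (- 1# * sum (λ k → a zero * u k) + - 1# * sum w)
      ≈⟨ +-assoc _ _ _ ⟨
    sum (λ k → a zero * u k) + - 1# * sum (λ k → a zero * u k) + - 1# * sum w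
      ≈⟨ +-cong (trans (+-comm _ _) (-1*x+x≈0 _)) (*-congˡ (w-cancels n a D D-cong)) ⟩
    0# + - 1# * 0#
      ≈⟨ trans (+-identityˡ _) (zeroʳ _) ⟩
    0# ∎
    where
    u v w : Fin (suc n) → Carrier
    u k = sign k * (a (suc k) * D (suc ∘ punchIn k))
    v j = sum (λ k → (- 1# * sign k) * (a (suc (punchIn j k)) * D (punchIn (suc j) ∘ punchIn (suc k))))
    w j = sign j * (a (suc j) * v j)

    split : ∀ j → (- 1# * sign j) * (a (suc j) * (1# * (a zero * D (punchIn (suc j) ∘ suc)) + v j))
                ≈ - 1# * (a zero * u j) + - 1# * w j
    split j = solve 6 (λ m s x z d y →
        (m :* s) :* (x :* (con 1 :* (z :* d) :+ y)) := m :* (z :* (s :* (x :* d))) :+ m :* (s :* (x :* y)))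
      refl (- 1#) (sign j) (a (suc j)) (a zero) (D (suc ∘ punchIn j)) (v j)

    -- The pairs that avoid column zero form the same double sum, one size smaller and up to the
    -- factor `- 1#`. Column zero stays in every remaining minor, whence `lift 1`; this is the
    -- induction step of `pairs-cancel`.
    w-cancels : ∀ n (a : Fin (2 ℕ.+ n) → Carrier) (D : (Fin n → Fin (2 ℕ.+ n)) → Carrier) →
      (∀ {σ τ} → (∀ i → σ i ≡ τ i) → D σ ≈ D τ) →
      sum {suc n} (λ j → sign j * (a (suc j) *
        sum (λ k → (- 1# * sign k) * (a (suc (punchIn j k)) * D (punchIn (suc j) ∘ punchIn (suc k)))))) ≈ 0#
    w-cancels zero a D D-cong = sum-ε {1} λ j → trans (*-congˡ {sign j} (zeroʳ (a (suc j)))) (zeroʳ (sign j))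
    w-cancels (suc n) a D D-cong = begin
      sum (λ j → sign j * (a (suc j) * sum (λ k → (- 1# * sign k) * (a (suc (punchIn j k)) * D (punchIn (suc j) ∘ punchIn (suc k))))))
        ≈⟨ sum-cong-≋ (λ j → *-congˡ {sign j} (*-congˡ {a (suc j)} (trans (sum-cong-≋ (reassoc j)) (sym (*-distribˡ-sum (- 1#) (z j)))))) ⟩
      sum (λ j → sign j * (a (suc j) * (- 1# * sum (z j))))
        ≈⟨ sum-cong-≋ (λ j → solve 4 (λ s x m y → s :* (x :* (m :* y)) := m :* (s :* (x :* y))) refl (sign j) (a (suc j)) (- 1#) (sum (z j))) ⟩
      sum (λ j → - 1# * (sign j * (a (suc j) * sum (z j))))
        ≈⟨ *-distribˡ-sum (- 1#) (λ j → sign j * (a (suc j) * sum (z j))) ⟨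
      - 1# * sum (λ j → sign j * (a (suc j) * sum (z j)))
        ≈⟨ *-congˡ (pairs-cancel n (a ∘ suc) (D ∘ lift 1) (λ σ≗τ → D-cong (lift-cong σ≗τ))) ⟩
      - 1# * 0#
        ≈⟨ zeroʳ _ ⟩
      0# ∎
      where
      z : Fin (2 ℕ.+ n) → Fin (suc n) → Carrier
      z j k = sign k * (a (suc (punchIn j k)) * D (lift 1 (punchIn j ∘ punchIn k)))

      lift-cong : ∀ {σ τ : Fin n → Fin (2 ℕ.+ n)} → (∀ i → σ i ≡ τ i) → ∀ i → lift 1 σ i ≡ lift 1 τ i
      lift-cong σ≗τ zero    = ≡.refl
      lift-cong σ≗τ (suc i) = ≡.cong suc (σ≗τ i)

      lift-punchIn : ∀ j (k : Fin (suc n)) i → punchIn (suc j) (punchIn (suc k) i) ≡ lift 1 (punchIn j ∘ punchIn k) i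
      lift-punchIn j k zero    = ≡.refl
      lift-punchIn j k (suc i) = ≡.refl

      reassoc : ∀ j k → (- 1# * sign k) * (a (suc (punchIn j k)) * D (punchIn (suc j) ∘ punchIn (suc k))) ≈ - 1# * z j k
      reassoc j k = trans (*-assoc _ _ _) (*-congˡ (*-congˡ (*-congˡ (D-cong (lift-punchIn j k)))))

  zero-minors : ∀ {n} (M : Matrix Carrier (suc n)) → (∀ k → det (minor M k) ≈ 0#) → det M ≈ 0#
  zero-minors M minors≈0 = sum-ε λ k →
    trans (*-congˡ {sign k} (trans (*-congˡ {M zero k} (minors≈0 k)) (zeroʳ (M zero k)))) (zeroʳ (sign k))

  -- For rows zero and one, expand along both and cancel pairs of columns. A later row is first
  -- exchanged with row one: both of these survive in every minor, so the hypothesis about the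
  -- smaller size justifies the exchange.
  det-vanishes-first : ∀ {n} → (∀ {i j : Fin n} → i ≢ j → VanishesOn det i j) →
                       ∀ j → VanishesOn (det {suc n}) zero (suc j)
  det-vanishes-first {suc n} _ zero M M0≈M1 = trans
    (sum-cong-≋ λ j → *-congˡ {sign j} (*-congˡ {M zero j} (sum-cong-≋ λ k →
      *-congˡ {sign k} (*-congʳ {det (minor (minor M j) k)} (sym (M0≈M1 (punchIn j k)))))))
    (pairs-cancel n (M zero) (λ σ → det λ p q → M (suc (suc p)) (σ q))
      λ σ≗τ → det-cong λ p q → reflexive (≡.cong (M (suc (suc p))) (σ≗τ q)))
  det-vanishes-first {suc n} vanishes (suc j) M M0≈Mj = begin
    det M                 ≈⟨ -‿involutive _ ⟨
    - - det M             ≈⟨ -‿cong swapped ⟨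
    - det M′              ≈⟨ -‿cong (det-vanishes-first vanishes zero M′ M0≈Mj) ⟩
    - 0#                  ≈⟨ -0#≈0# ⟩
    0#                    ∎
    where
    M′ : Matrix Carrier (suc (suc n))
    M′ = M zero ◂ (M (suc (suc j)) ◂ updateAt (tail (tail M)) j (const (M (suc zero))))

    M′-other : ∀ p → p ≢ suc zero → p ≢ suc (suc j) → ∀ q → M′ p q ≈ M p q
    M′-other zero          _    _    q = refl
    M′-other (suc zero)    p≢1  _    q = contradiction ≡.refl p≢1
    M′-other (suc (suc p)) _    p≢j  q =
      reflexive (≡.cong (λ r → r q) (updateAt-minimal p j (tail (tail M)) λ p≡j → p≢j (≡.cong (λ i → suc (suc i)) p≡j)))

    swapped : det M′ ≈ - det M
    swapped = swap det-multilinear {suc zero} {suc (suc j)}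
      (λ P Pi≈Pj → zero-minors P λ k →
        vanishes {zero} {suc j} (λ ()) (minor P k) λ q → Pi≈Pj (punchIn k q))
      (λ ()) (λ q → refl)
      (λ q → reflexive (≡.cong (λ r → r q) (updateAt-updates j (tail (tail M)))))
      M′-other

  det-vanishes : ∀ {n} {i j : Fin n} → i ≢ j → VanishesOn det i j
  det-vanishes {i = zero}  {zero}  i≢j M M0≈Mj = contradiction ≡.refl i≢j
  det-vanishes {i = zero}  {suc j} _   M M0≈Mj = det-vanishes-first det-vanishes j M M0≈Mj
  det-vanishes {i = suc i} {zero}  _   M Mi≈M0 = det-vanishes-first det-vanishes i M (sym ∘ Mi≈M0)
  det-vanishes {i = suc i} {suc j} i≢j M Mi≈Mj = zero-minors M λ k →
    det-vanishes (i≢j ∘ ≡.cong suc) (minor M k) λ q → Mi≈Mj (punchIn k q)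

  -- Alternating forms are multiples of the determinant

  I : ∀ {n} → Matrix Carrier n
  I = diagonal 0# (const 1#)

  sum-I : ∀ {n} (a : Fin n → Carrier) q → sum (λ j → a j * I j q) ≈ a q
  sum-I a zero    = trans (+-cong (*-identityʳ _) (sum-ε λ j → zeroʳ (a (suc j)))) (+-identityʳ _)
  sum-I a (suc q) = trans (+-cong (zeroʳ _) (sum-I (a ∘ suc) q)) (+-identityˡ _)

  expand-head : ∀ {n N k} {f : Rows (suc n) N → Carrier} → Multilinear f →
                ∀ (a : Fin k → Carrier) (V : Rows k N) r M →
                (∀ q → r q ≈ sum (λ j → a j * V j q)) →
                f (r ◂ M) ≈ sum (λ j → a j * f (V j ◂ M))
  expand-head {k = zero}  ml a V r M r≈ = zero-row ml zero r≈
  expand-head {N = N} {suc k} {f} ml a V r M r≈ = begin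
    f (r ◂ M)
      ≈⟨ Multilinear.linear ml zero (a zero) (below (V zero)) (below rest) r≈ ⟩
    a zero * f (V zero ◂ M) + f (rest ◂ M)
      ≈⟨ +-congˡ (expand-head ml (a ∘ suc) (V ∘ suc) rest M (λ _ → refl)) ⟩
    a zero * f (V zero ◂ M) + sum (λ j → a (suc j) * f (V (suc j) ◂ M)) ∎
    where
    rest : Fin N → Carrier
    rest q = sum (λ j → a (suc j) * V (suc j) q)

    below : ∀ s p → p ≢ zero → ∀ q → (r ◂ M) p q ≈ (s ◂ M) p q
    below s zero    0≢0 q = contradiction ≡.refl 0≢0
    below s (suc p) _   q = refl

  -- Telescoping: the rows are exchanged one at a time, and no exchange alters `g`. The relation is
  -- a parameter because in `clear-column` two related rows differ by a multiple of a pivot row and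
  -- are not equal.
  rowwise : ∀ {n N ℓ′} (_∼_ : (Fin N → Carrier) → (Fin N → Carrier) → Set ℓ′) (g : Rows n N → Carrier) →
            (∀ {M M′} → (∀ p q → M p q ≈ M′ p q) → g M ≈ g M′) →
            (∀ i {M M′} → (∀ p → p ≢ i → ∀ q → M p q ≈ M′ p q) → M i ∼ M′ i → g M ≈ g M′) →
            ∀ {M M′} → (∀ p → M p ∼ M′ p) → g M ≈ g M′
  rowwise {zero}  _∼_ g g-cong g-step M∼M′ = g-cong λ ()
  rowwise {suc n} _∼_ g g-cong g-step {M} {M′} M∼M′ = begin
    g M                       ≈⟨ g-cong (λ { zero q → refl ; (suc p) q → refl }) ⟩
    g (M zero ◂ tail M)       ≈⟨ rowwise _∼_ (λ T → g (M zero ◂ T))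
                                   (λ T≈T′ → g-cong λ { zero q → refl ; (suc p) q → T≈T′ p q })
                                   (λ i T≈T′ → g-step (suc i) λ where
                                     zero    _   q → refl
                                     (suc p) p≢i q → T≈T′ p (p≢i ∘ ≡.cong suc) q)
                                   (M∼M′ ∘ suc) ⟩
    g (M zero ◂ tail M′)      ≈⟨ g-step zero (λ where
                                     zero    0≢0 q → contradiction ≡.refl 0≢0
                                     (suc p) _   q → refl)
                                   (M∼M′ zero) ⟩
    g M′                      ∎

  punchIn-elim : ∀ {n p} (P : Fin (suc n) → Set p) j → P j → (∀ q → P (punchIn j q)) → ∀ q → P q
  punchIn-elim P j Pj Pin q with j ≟ q
  ... | yes ≡.refl = Pj
  ... | no  j≢q    = ≡.subst P (punchIn-punchOut j≢q) (Pin _)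

  insert0 : ∀ {n} → Fin (suc n) → (Fin n → Carrier) → Fin (suc n) → Carrier
  insert0 j x = insertAt x j 0#

  insert0-linear : ∀ {n} j a {x y z : Fin n → Carrier} → (∀ q → z q ≈ a * x q + y q) →
                   ∀ q → insert0 j z q ≈ a * insert0 j x q + insert0 j y q
  insert0-linear j a {x} {y} {z} z≈ = punchIn-elim _ j at-j at-other
    where
    at-j : insert0 j z j ≈ a * insert0 j x j + insert0 j y j
    at-j rewrite insertAt-lookup x j 0# | insertAt-lookup y j 0# | insertAt-lookup z j 0# =
      sym (trans (+-identityʳ _) (zeroʳ a))
    at-other : ∀ q → insert0 j z (punchIn j q) ≈ a * insert0 j x (punchIn j q) + insert0 j y (punchIn j q)
    at-other q rewrite insertAt-punchIn x j 0# q | insertAt-punchIn y j 0# q | insertAt-punchIn z j 0# q = z≈ q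

  insert0-cong : ∀ {n} j {x y : Fin n → Carrier} → (∀ q → x q ≈ y q) → ∀ q → insert0 j x q ≈ insert0 j y q
  insert0-cong j {x} {y} x≈y q = trans
    -- Congruence is the linear law with coefficient `0#`: then `x` is `0#` times itself plus `y`.
    (insert0-linear j 0# {x} {y} (λ q → trans (x≈y q) (sym (trans (+-congʳ (zeroˡ _)) (+-identityˡ _)))) q)
    (trans (+-congʳ (zeroˡ _)) (+-identityˡ _))

  -- A unit pivot in the first row and column `j`, with `M` as its minor. Composition with it turns
  -- an alternating form of size `suc n` into one of size `n`, which drives the induction in
  -- `alternating-unique`.
  border : ∀ {n} → Fin (suc n) → Matrix Carrier n → Matrix Carrier (suc n)
  border j M = I j ◂ (insert0 j ∘ M)

  border-alternating : ∀ {n} {f : Matrix Carrier (suc n) → Carrier} → Alternating f →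
                       ∀ j → Alternating (f ∘ border j)
  border-alternating {f = f} alt j = record
    { multilinear = record
      { cong   = λ M≈M′ → cong λ where
          zero    q → refl
          (suc p) q → insert0-cong j (M≈M′ p) q
      ; linear = λ i a P≈M P≈M′ Pi → linear (suc i) a
          (λ where
            zero    _   q → refl
            (suc p) p≢i q → insert0-cong j (P≈M p (p≢i ∘ ≡.cong suc)) q)
          (λ where
            zero    _   q → refl
            (suc p) p≢i q → insert0-cong j (P≈M′ p (p≢i ∘ ≡.cong suc)) q)
          (insert0-linear j a Pi)
      }
    ; alternate = λ i≢i′ M Mi≈Mi′ →
        alternate (i≢i′ ∘ suc-injective) (border j M) (insert0-cong j Mi≈Mi′)
    }
    where open Alternating alt

  -- Multiples of the first row I j clear the column j below it.
  clear-column : ∀ {n} {f : Matrix Carrier (suc n) → Carrier} → Alternating f →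
                 ∀ j (M : Rows n (suc n)) → f (I j ◂ M) ≈ f (border j (λ p q → M p (punchIn j q)))
  clear-column {n} {f} alt j M =
    rowwise _∼_ (λ T → f (I j ◂ T)) (λ T≈T′ → cong λ { zero q → refl ; (suc p) q → T≈T′ p q }) step cleared
    where
    open Alternating alt
    _∼_ : (Fin (suc n) → Carrier) → (Fin (suc n) → Carrier) → Set ℓ
    x ∼ y = ∀ q → x q ≈ x j * I j q + y q

    cleared : ∀ p → M p ∼ insert0 j (λ q → M p (punchIn j q))
    cleared p = punchIn-elim _ j at-j at-other
      where
      x = λ q → M p (punchIn j q)
      at-j : M p j ≈ M p j * I j j + insert0 j x j
      at-j rewrite insertAt-lookup x j 0# | diagonal-≡ {z = 0#} (λ _ → 1#) j =
        sym (trans (+-identityʳ _) (*-identityʳ _))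
      at-other : ∀ q → M p (punchIn j q) ≈ M p j * I j (punchIn j q) + insert0 j x (punchIn j q)
      at-other q rewrite insertAt-punchIn x j 0# q
                       | diagonal-≢ {z = 0#} (λ _ → 1#) (punchInᵢ≢i j q ∘ ≡.sym) =
        sym (trans (+-congʳ (zeroʳ _)) (+-identityˡ _))

    step : ∀ i {T T′} → (∀ p → p ≢ i → ∀ q → T p q ≈ T′ p q) → T i ∼ T′ i → f (I j ◂ T) ≈ f (I j ◂ T′)
    step i {T} {T′} T≈T′ Ti∼T′i = begin
      f (I j ◂ T)                            ≈⟨ linear (suc i) (T i j)
                                                  (λ where
                                                    zero    _   q → refl
                                                    (suc p) p≢i q → reflexive (≡.cong (λ r → r q)
                                                      (≡.sym (updateAt-minimal p i T (p≢i ∘ ≡.cong suc)))))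
                                                  (λ where
                                                    zero    _   q → refl
                                                    (suc p) p≢i q → T≈T′ p (p≢i ∘ ≡.cong suc) q)
                                                  (λ q → trans (Ti∼T′i q) (+-congʳ (*-congˡ (reflexive (Iⱼ q))))) ⟩
      T i j * f (I j ◂ twice) + f (I j ◂ T′) ≈⟨ +-congʳ (*-congˡ (alternate {zero} {suc i} (λ ()) (I j ◂ twice) (reflexive ∘ Iⱼ))) ⟩
      T i j * 0# + f (I j ◂ T′)              ≈⟨ trans (+-congʳ (zeroʳ _)) (+-identityˡ _) ⟩
      f (I j ◂ T′)                           ∎
      where
      twice : Rows n (suc n)
      twice = updateAt T i (const (I j))
      Iⱼ : ∀ q → I j q ≡ twice i q
      Iⱼ q = ≡.cong (λ r → r q) (≡.sym (updateAt-updates i T))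

  -- `border j I` is the identity with row `j` moved to the top. Each transposition of the two top
  -- rows contributes one factor `- 1#` and leaves the same problem for `j` lowered by one, inside a
  -- further border.
  border-I : ∀ {n} {f : Matrix Carrier (suc n) → Carrier} → Alternating f →
             ∀ j → f (border j I) ≈ sign j * f I
  border-I {f = f} alt zero = trans (cong border≈I) (sym (*-identityˡ _))
    where
    open Alternating alt
    border≈I : ∀ p q → border zero I p q ≈ I p q
    border≈I zero    q       = refl
    border≈I (suc p) zero    = refl
    border≈I (suc p) (suc q) = refl
  border-I {suc n} {f} alt (suc j) = begin
    f (border (suc j) I)                      ≈⟨ swap multilinear {zero} {suc zero} (alternate λ ()) (λ ()) row₀ row₁ rows ⟩
    - f (border zero (border j I))            ≈⟨ -‿cong (border-I (border-alternating alt zero) j) ⟩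
    - (sign j * f (border zero I))            ≈⟨ -‿cong (*-congˡ (trans (border-I alt zero) (*-identityˡ _))) ⟩
    - (sign j * f I)                          ≈⟨ -1*x≈-x _ ⟨
    - 1# * (sign j * f I)                     ≈⟨ *-assoc _ _ _ ⟨
    sign (suc j) * f I                        ∎
    where
    open Alternating alt
    row₀ : ∀ q → border (suc j) I zero q ≈ border zero (border j I) (suc zero) q
    row₀ zero    = refl
    row₀ (suc q) = refl
    row₁ : ∀ q → border (suc j) I (suc zero) q ≈ border zero (border j I) zero q
    row₁ zero    = refl
    row₁ (suc q) = punchIn-elim (λ q → insertAt (λ _ → 0#) j 0# q ≈ 0#) j
      (reflexive (insertAt-lookup (λ _ → 0#) j 0#))
      (λ q → reflexive (insertAt-punchIn (λ _ → 0#) j 0# q)) q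
    rows : ∀ p → p ≢ zero → p ≢ suc zero → ∀ q → border (suc j) I p q ≈ border zero (border j I) p q
    rows zero          0≢0 _   q       = contradiction ≡.refl 0≢0
    rows (suc zero)    _   1≢1 q       = contradiction ≡.refl 1≢1
    rows (suc (suc p)) _   _   zero    = refl
    rows (suc (suc p)) _   _   (suc q) = refl

  -- Expanding `f` along the first row and clearing the column below each unit pivot reproduces the
  -- Laplace recursion of `det`. Products, permutations and block triangular matrices are all
  -- treated by exhibiting an alternating form and computing its value at `I`.
  alternating-unique : ∀ {n} {f : Matrix Carrier n → Carrier} → Alternating f → ∀ M → f M ≈ det M * f I
  alternating-unique {zero}  {f} alt M = trans (Alternating.cong alt λ ()) (sym (*-identityˡ _))
  alternating-unique {suc n} {f} alt M = begin
    f M                                             ≈⟨ cong (λ { zero q → refl ; (suc p) q → refl }) ⟩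
    f (M zero ◂ tail M)                             ≈⟨ expand-head multilinear (M zero) I (M zero) (tail M) (λ q → sym (sum-I (M zero) q)) ⟩
    sum (λ j → M zero j * f (I j ◂ tail M))         ≈⟨ sum-cong-≋ term ⟩
    sum (λ j → sign j * (M zero j * det (minor M j)) * f I)
                                                    ≈⟨ *-distribʳ-sum (f I) (λ j → sign j * (M zero j * det (minor M j))) ⟨
    det M * f I                                     ∎
    where
    open Alternating alt
    term : ∀ j → M zero j * f (I j ◂ tail M) ≈ sign j * (M zero j * det (minor M j)) * f I
    term j = begin
      M zero j * f (I j ◂ tail M)                         ≈⟨ *-congˡ (clear-column alt j (tail M)) ⟩
      M zero j * f (border j (minor M j))                 ≈⟨ *-congˡ (alternating-unique (border-alternating alt j) (minor M j)) ⟩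
      M zero j * (det (minor M j) * f (border j I))       ≈⟨ *-congˡ (*-congˡ (border-I alt j)) ⟩
      M zero j * (det (minor M j) * (sign j * f I))       ≈⟨ solve 4 (λ m d s x → m :* (d :* (s :* x)) := s :* (m :* d) :* x) refl _ _ _ _ ⟩
      sign j * (M zero j * det (minor M j)) * f I         ∎

  infixl 7 _⊗_
  _⊗_ : ∀ {n k N} → Rows n k → Rows k N → Rows n N
  (A ⊗ B) i j = sum λ k → A i k * B k j

  det-unit-row : ∀ {n} (M : Matrix Carrier (suc n)) → M zero zero ≈ 1# → (∀ j → M zero (suc j) ≈ 0#) →
                 det M ≈ det (minor M zero)
  det-unit-row M M00≈1 M0j≈0 = begin
    1# * (M zero zero * det (minor M zero)) + sum (λ j → sign (suc j) * (M zero (suc j) * det (minor M (suc j))))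
      ≈⟨ +-cong (trans (*-identityˡ _) (trans (*-congʳ M00≈1) (*-identityˡ _)))
                (sum-ε λ j → trans (*-congˡ {sign (suc j)} (trans (*-congʳ {det (minor M (suc j))} (M0j≈0 j)) (zeroˡ (det (minor M (suc j)))))) (zeroʳ (sign (suc j)))) ⟩
    det (minor M zero) + 0#
      ≈⟨ +-identityʳ _ ⟩
    det (minor M zero) ∎

  det-I : ∀ n → det (I {n}) ≈ 1#
  det-I zero    = refl
  det-I (suc n) = trans (det-unit-row (I {suc n}) refl (λ _ → refl)) (det-I n)

  I-⊗ : ∀ {n N} (B : Rows n N) i j → (I ⊗ B) i j ≈ B i j
  I-⊗ B zero    j = trans (+-cong (*-identityˡ _) (sum-ε λ k → zeroˡ (B (suc k) j))) (+-identityʳ _)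
  I-⊗ B (suc i) j = trans (+-cong (zeroˡ _) (I-⊗ (tail B) i j)) (+-identityˡ _)

  -- For fixed `B` the left side is alternating in the rows of `A`, and its value at `I` is `det B`.
  det-⊗ : ∀ {n} (A B : Matrix Carrier n) → det (A ⊗ B) ≈ det A * det B
  det-⊗ {n} A B = trans (alternating-unique alt A) (*-congˡ (det-cong (I-⊗ B)))
    where
    ⊗-congʳ : ∀ {A A′ : Matrix Carrier n} i i′ → (∀ q → A i q ≈ A′ i′ q) → ∀ j → (A ⊗ B) i j ≈ (A′ ⊗ B) i′ j
    ⊗-congʳ i i′ A≈A′ j = sum-cong-≋ λ k → *-congʳ {B k j} (A≈A′ k)

    alt : Alternating (λ A → det (A ⊗ B))
    alt = record
      { multilinear = record
        { cong   = λ {A} {A′} A≈A′ → det-cong λ i → ⊗-congʳ {A} {A′} i i (A≈A′ i)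
        ; linear = λ i a {M} {M′} {P} P≈M P≈M′ Pi → Multilinear.linear det-multilinear i a
            (λ p p≢i → ⊗-congʳ {P} {M} p p (P≈M p p≢i))
            (λ p p≢i → ⊗-congʳ {P} {M′} p p (P≈M′ p p≢i))
            λ j → begin
              sum (λ k → P i k * B k j)
                ≈⟨ sum-cong-≋ (λ k → trans (*-congʳ (Pi k))
                     (solve 4 (λ a x y b → (a :* x :+ y) :* b := a :* (x :* b) :+ y :* b) refl a (M i k) (M′ i k) (B k j))) ⟩
              sum (λ k → a * (M i k * B k j) + M′ i k * B k j)
                ≈⟨ ∑-distrib-+ (λ k → a * (M i k * B k j)) (λ k → M′ i k * B k j) ⟩
              sum (λ k → a * (M i k * B k j)) + (M′ ⊗ B) i j
                ≈⟨ +-congʳ (*-distribˡ-sum a (λ k → M i k * B k j)) ⟨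
              a * (M ⊗ B) i j + (M′ ⊗ B) i j ∎
        }
      ; alternate = λ {i} {j} i≢j M Mi≈Mj → det-vanishes i≢j (M ⊗ B) (⊗-congʳ {M} {M} i j Mi≈Mj)
      }

  -- The form `det ∘ permuted` is alternating. Rows and columns move together, so `permuted` fixes
  -- `I` and no sign of `π` appears.
  det-permute : ∀ {n} (π : Permutation n n) (M : Matrix Carrier n) →
                det (λ i j → M (π ⟨$⟩ʳ i) (π ⟨$⟩ʳ j)) ≈ det M
  det-permute {n} π M = begin
    det (permuted M)          ≈⟨ alternating-unique alt M ⟩
    det M * det (permuted I)  ≈⟨ *-congˡ (det-cong λ i j → reflexive (diagonal-restrict _ _ (π ⟨$⟩ʳ_) π-injective (λ _ → ≡.refl) i j)) ⟩
    det M * det (I {n})       ≈⟨ trans (*-congˡ (det-I n)) (*-identityʳ _) ⟩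
    det M                     ∎
    where
    permuted : Matrix Carrier n → Matrix Carrier n
    permuted M i j = M (π ⟨$⟩ʳ i) (π ⟨$⟩ʳ j)

    π-injective : ∀ {i j} → π ⟨$⟩ʳ i ≡ π ⟨$⟩ʳ j → i ≡ j
    π-injective eq = ≡.trans (≡.sym (inverseˡ π)) (≡.trans (≡.cong (π ⟨$⟩ˡ_) eq) (inverseˡ π))

    back : ∀ {i p} → p ≢ π ⟨$⟩ˡ i → π ⟨$⟩ʳ p ≢ i
    back p≢ πp≡i = p≢ (≡.trans (≡.sym (inverseˡ π)) (≡.cong (π ⟨$⟩ˡ_) πp≡i))

    alt : Alternating (det ∘ permuted)
    alt = record
      { multilinear = record
        { cong   = λ M≈M′ → det-cong λ i j → M≈M′ (π ⟨$⟩ʳ i) (π ⟨$⟩ʳ j)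
        ; linear = λ i a {M} {M′} {P} P≈M P≈M′ Pi → Multilinear.linear det-multilinear (π ⟨$⟩ˡ i) a
            (λ p p≢ q → P≈M (π ⟨$⟩ʳ p) (back p≢) (π ⟨$⟩ʳ q))
            (λ p p≢ q → P≈M′ (π ⟨$⟩ʳ p) (back p≢) (π ⟨$⟩ʳ q))
            (λ q → ≡.subst (λ k → P k (π ⟨$⟩ʳ q) ≈ a * M k (π ⟨$⟩ʳ q) + M′ k (π ⟨$⟩ʳ q))
                     (≡.sym (inverseʳ π)) (Pi (π ⟨$⟩ʳ q)))
        }
      ; alternate = λ {i} {j} i≢j M Mi≈Mj → det-vanishes {i = π ⟨$⟩ˡ i} {π ⟨$⟩ˡ j}
          (λ eq → i≢j (≡.trans (≡.sym (inverseʳ π)) (≡.trans (≡.cong (π ⟨$⟩ʳ_) eq) (inverseʳ π))))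
          (permuted M)
          (λ q → ≡.subst₂ (λ k l → M k (π ⟨$⟩ʳ q) ≈ M l (π ⟨$⟩ʳ q))
                   (≡.sym (inverseʳ π)) (≡.sym (inverseʳ π)) (Mi≈Mj (π ⟨$⟩ʳ q)))
      }

  -- Determinants of block matrices and elimination

  Block : ℕ → ℕ → Set c
  Block a b = Fin a ⊎ Fin b → Fin a ⊎ Fin b → Carrier

  flatten : ∀ {a b} → Block a b → Matrix Carrier (a ℕ.+ b)
  flatten {a} N i j = N (splitAt a i) (splitAt a j)

  lowerBlock : ∀ {a b} → Matrix Carrier a → Rows b a → Matrix Carrier b → Block a b
  lowerBlock Z C W (inj₁ p) (inj₁ q) = Z p q
  lowerBlock Z C W (inj₁ p) (inj₂ w) = 0#
  lowerBlock Z C W (inj₂ w) (inj₁ q) = C w q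
  lowerBlock Z C W (inj₂ w) (inj₂ v) = W w v

  -- The first row is a unit vector, so each step deletes one row of the identity together with one
  -- column of `C`.
  det-lowerBlock-I : ∀ {a b} (C : Rows b a) (W : Matrix Carrier b) → det (flatten (lowerBlock I C W)) ≈ det W
  det-lowerBlock-I {zero}  C W = refl
  det-lowerBlock-I {suc a} C W = begin
    det (flatten (lowerBlock I C W))                ≈⟨ det-unit-row (flatten (lowerBlock I C W)) refl (λ j → head-row (splitAt a j)) ⟩
    det (minor (flatten (lowerBlock I C W)) zero)   ≈⟨ det-cong (λ i j → tail-rows (splitAt a i) (splitAt a j)) ⟩
    det (flatten (lowerBlock I (λ w → C w ∘ suc) W)) ≈⟨ det-lowerBlock-I (λ w → C w ∘ suc) W ⟩
    det W                                           ∎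
    where
    head-row : ∀ s → lowerBlock I C W (inj₁ zero) (map₁ suc s) ≈ 0#
    head-row (inj₁ _) = refl
    head-row (inj₂ _) = refl

    tail-rows : ∀ s t → lowerBlock I C W (map₁ suc s) (map₁ suc t) ≈ lowerBlock I (λ w → C w ∘ suc) W s t
    tail-rows (inj₁ _) (inj₁ _) = refl
    tail-rows (inj₁ _) (inj₂ _) = refl
    tail-rows (inj₂ _) (inj₁ _) = refl
    tail-rows (inj₂ _) (inj₂ _) = refl

  -- With `C` and `W` fixed, the determinant is an alternating form in `Z`: a row of `Z` is
  -- continued by zeros only, so linear relations between rows extend to the whole matrix.
  det-lowerBlock : ∀ {a b} (Z : Matrix Carrier a) (C : Rows b a) (W : Matrix Carrier b) →
                   det (flatten (lowerBlock Z C W)) ≈ det Z * det W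
  det-lowerBlock {a} {b} Z C W = trans (alternating-unique alt Z) (*-congˡ (det-lowerBlock-I C W))
    where
    L : Matrix Carrier a → Block a b
    L Z = lowerBlock Z C W

    row≈ : ∀ {Z Z′ i i′} → (∀ q → Z i q ≈ Z′ i′ q) → ∀ t → L Z (inj₁ i) t ≈ L Z′ (inj₁ i′) t
    row≈ Zi≈ (inj₁ q) = Zi≈ q
    row≈ Zi≈ (inj₂ w) = refl

    other-rows : ∀ {Z Z′} i → (∀ p → p ≢ i → ∀ q → Z p q ≈ Z′ p q) →
                 ∀ x → x ≢ i ↑ˡ b → ∀ y → flatten (L Z) x y ≈ flatten (L Z′) x y
    other-rows {Z} {Z′} i Z≈Z′ x x≢i y with splitAt a x in eq
    ... | inj₁ p = row≈ {Z} {Z′} (Z≈Z′ p λ { ≡.refl → x≢i (≡.sym (splitAt⁻¹-↑ˡ eq)) }) (splitAt a y)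
    ... | inj₂ w = low (splitAt a y)
      where
      low : ∀ t → L Z (inj₂ w) t ≈ L Z′ (inj₂ w) t
      low (inj₁ _) = refl
      low (inj₂ _) = refl

    alt : Alternating (λ Z → det (flatten (L Z)))
    alt = record
      { multilinear = record
        { cong   = λ {Z} {Z′} Z≈Z′ → det-cong λ i j → entry Z≈Z′ (splitAt a i) (splitAt a j)
        ; linear = λ i s {M} {M′} {P} P≈M P≈M′ Pi → Multilinear.linear det-multilinear (i ↑ˡ b) s
            (other-rows {P} {M} i P≈M)
            (other-rows {P} {M′} i P≈M′)
            (row-linear i s Pi)
        }
      ; alternate = λ {i} {j} i≢j M Mi≈Mj → det-vanishes {i = i ↑ˡ b} {j ↑ˡ b}
          (i≢j ∘ ↑ˡ-injective b i j) (flatten (L M)) (equal-rows Mi≈Mj)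
      }
      where
      entry : ∀ {Z Z′} → (∀ p q → Z p q ≈ Z′ p q) → ∀ s t → L Z s t ≈ L Z′ s t
      entry Z≈Z′ (inj₁ p) (inj₁ q) = Z≈Z′ p q
      entry Z≈Z′ (inj₁ p) (inj₂ w) = refl
      entry Z≈Z′ (inj₂ w) (inj₁ q) = refl
      entry Z≈Z′ (inj₂ w) (inj₂ v) = refl

      row-linear : ∀ i s {M M′ P : Matrix Carrier a} → (∀ q → P i q ≈ s * M i q + M′ i q) →
                   ∀ y → flatten (L P) (i ↑ˡ b) y ≈ s * flatten (L M) (i ↑ˡ b) y + flatten (L M′) (i ↑ˡ b) y
      row-linear i s Pi y rewrite splitAt-↑ˡ a i b with splitAt a y
      ... | inj₁ q = Pi q
      ... | inj₂ w = sym (trans (+-identityʳ _) (zeroʳ s))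

      equal-rows : ∀ {i j M} → (∀ q → M i q ≈ M j q) →
                   ∀ y → flatten (L M) (i ↑ˡ b) y ≈ flatten (L M) (j ↑ˡ b) y
      equal-rows {i} {j} {M} Mi≈Mj y rewrite splitAt-↑ˡ a i b | splitAt-↑ˡ a j b = row≈ {M} {M} Mi≈Mj (splitAt a y)

  copies : ∀ k {l} → Matrix Carrier l → Fin k × Fin l → Fin k × Fin l → Carrier
  copies k Y (i , w) (j , v) = if does (i ≟ j) then Y w v else 0#

  det-copies : ∀ k {l} (Y : Matrix Carrier l) →
               det (λ x y → copies k Y (remQuot l x) (remQuot l y)) ≈ det Y ^ k
  det-copies zero    {l} Y = refl
  det-copies (suc k) {l} Y = begin
    det (λ x y → copies (suc k) Y (remQuot l x) (remQuot l y))
      ≈⟨ det-cong (λ x y → reflexive (≡.cong₂ (copies (suc k) Y) (remQuot-suc x) (remQuot-suc y))) ⟩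
    det (λ x y → copies (suc k) Y (fromSplit l (splitAt l x)) (fromSplit l (splitAt l y)))
      ≈⟨ det-cong (λ x y → blocks (splitAt l x) (splitAt l y)) ⟩
    det (flatten (lowerBlock Y (λ _ _ → 0#) (λ x y → copies k Y (remQuot l x) (remQuot l y))))
      ≈⟨ det-lowerBlock Y _ _ ⟩
    det Y * det (λ x y → copies k Y (remQuot l x) (remQuot l y))
      ≈⟨ *-congˡ (det-copies k Y) ⟩
    det Y * det Y ^ k ∎
    where
    blocks : ∀ s t → copies (suc k) Y (fromSplit l s) (fromSplit l t) ≈
                     lowerBlock Y (λ _ _ → 0#) (λ x y → copies k Y (remQuot l x) (remQuot l y)) s t
    blocks (inj₁ _) (inj₁ _) = refl
    blocks (inj₁ _) (inj₂ _) = refl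
    blocks (inj₂ _) (inj₁ _) = refl
    blocks (inj₂ _) (inj₂ _) = refl

  bordered : ∀ {a b} → Matrix Carrier a → Rows a b → Rows b a → Matrix Carrier b → Block a b
  bordered A B C W (inj₁ p) (inj₁ q) = A p q
  bordered A B C W (inj₁ p) (inj₂ w) = B p w
  bordered A B C W (inj₂ w) (inj₁ q) = C w q
  bordered A B C W (inj₂ w) (inj₂ v) = W w v

  scalar : ∀ {n} → Carrier → Matrix Carrier n
  scalar t = diagonal 0# (const t)

  scalar-⊗ : ∀ {n N} t (B : Rows n N) i j → (scalar t ⊗ B) i j ≈ t * B i j
  scalar-⊗ t B zero    j = trans (+-congˡ (sum-ε λ k → zeroˡ (B (suc k) j))) (+-identityʳ _)
  scalar-⊗ t B (suc i) j = trans (+-cong (zeroˡ _) (scalar-⊗ t (tail B) i j)) (+-identityˡ _)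

  -- The scalar `t` stands on the whole diagonal, so that for monic `t` of positive degree and `J`
  -- of smaller degree all diagonal entries dominate uniformly and `monic-det` makes the determinant
  -- cancellable.
  eliminator : ∀ {a b} → Carrier → Rows a b → Block a b
  eliminator t J = bordered (scalar t) J (λ _ _ → 0#) (scalar t)

  -- A Schur complement computed without inverting W: left multiplication by
  -- the eliminator clears the block B.
  det-bordered : ∀ {a b} (A : Matrix Carrier a) (B : Rows a b) (C : Rows b a) (W : Matrix Carrier b)
                 (t : Carrier) (J : Rows a b) → (∀ p w → (J ⊗ W) p w ≈ - (t * B p w)) →
                 det (flatten (eliminator t J)) * det (flatten (bordered A B C W))
                 ≈ det (λ p q → t * A p q + (J ⊗ C) p q) * (det (scalar {b} t) * det W)
  det-bordered {a} {b} A B C W t J JW≈-tB = begin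
    det (flatten L) * det (flatten M)
      ≈⟨ det-⊗ (flatten L) (flatten M) ⟨
    det (flatten L ⊗ flatten M)
      ≈⟨ det-cong (λ i j → trans (sum-⊎ a (λ s → L (splitAt a i) s * M s (splitAt a j))) (entry (splitAt a i) (splitAt a j))) ⟩
    det (flatten (lowerBlock A′ (scalar t ⊗ C) (scalar t ⊗ W)))
      ≈⟨ det-lowerBlock A′ (scalar t ⊗ C) (scalar t ⊗ W) ⟩
    det A′ * det (scalar t ⊗ W)
      ≈⟨ *-congˡ (det-⊗ (scalar t) W) ⟩
    det A′ * (det (scalar {b} t) * det W) ∎
    where
    L = eliminator t J
    M = bordered A B C W
    A′ : Matrix Carrier a
    A′ p q = t * A p q + (J ⊗ C) p q

    entry : ∀ s u → sum (λ p → L s (inj₁ p) * M (inj₁ p) u) + sum (λ w → L s (inj₂ w) * M (inj₂ w) u)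
                    ≈ lowerBlock A′ (scalar t ⊗ C) (scalar t ⊗ W) s u
    entry (inj₁ p) (inj₁ q) = +-congʳ (scalar-⊗ t A p q)
    entry (inj₁ p) (inj₂ w) = trans (+-cong (scalar-⊗ t B p w) (JW≈-tB p w)) (-‿inverseʳ _)
    entry (inj₂ w) (inj₁ q) = trans (+-congʳ (sum-ε λ p → zeroˡ (A p q))) (+-identityˡ _)
    entry (inj₂ w) (inj₂ v) = trans (+-congʳ (sum-ε λ p → zeroˡ (B p v))) (+-identityˡ _)

-- The polynomial ring, degree bounds and cancellation of monic factors

module PolynomialProperties {c ℓ} (R : CommutativeRing c ℓ) where
  open CommutativeRing R hiding (zero)
  open Polynomial rawRing
  open NatSolver commutativeSemiring using (solve; _:=_; _:+_; _:*_; con)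
  open SetoidReasoning setoid
  private module P = RawRing polyRing
  open P using () renaming (_≈_ to _≈ᴾ_)

  scale : Carrier → Poly → Poly
  scale a = map (a *_)

  shift : Poly → Poly
  shift p = 0# ∷ p

  coeff-+ : ∀ p q i → coeff (p +ᴾ q) i ≈ coeff p i + coeff q i
  coeff-+ []      q       i       = sym (+-identityˡ _)
  coeff-+ (a ∷ p) []      i       = sym (+-identityʳ _)
  coeff-+ (a ∷ p) (b ∷ q) zero    = refl
  coeff-+ (a ∷ p) (b ∷ q) (suc i) = coeff-+ p q i

  coeff-scale : ∀ a p i → coeff (scale a p) i ≈ a * coeff p i
  coeff-scale a []      i       = sym (zeroʳ a)
  coeff-scale a (b ∷ p) zero    = refl
  coeff-scale a (b ∷ p) (suc i) = coeff-scale a p i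

  coeff-neg : ∀ p i → coeff (P.- p) i ≈ - coeff p i
  coeff-neg []      i       = sym (RingProperties.-0#≈0# ring)
  coeff-neg (a ∷ p) zero    = refl
  coeff-neg (a ∷ p) (suc i) = coeff-neg p i

  coeff-shift-cong : ∀ p q → p ≈ᴾ q → shift p ≈ᴾ shift q
  coeff-shift-cong p q p≈q zero    = refl
  coeff-shift-cong p q p≈q (suc i) = p≈q i

  coeff-shift-+ : ∀ p q i → coeff (shift (p +ᴾ q)) i ≈ coeff (shift p) i + coeff (shift q) i
  coeff-shift-+ p q zero    = sym (+-identityˡ _)
  coeff-shift-+ p q (suc i) = coeff-+ p q i

  coeff-shift-scale : ∀ a p i → coeff (shift (scale a p)) i ≈ a * coeff (shift p) i
  coeff-shift-scale a p zero    = sym (zeroʳ a)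
  coeff-shift-scale a p (suc i) = coeff-scale a p i

  coeff-∷-* : ∀ a p q i → coeff ((a ∷ p) *ᴾ q) i ≈ a * coeff q i + coeff (shift (p *ᴾ q)) i
  coeff-∷-* a p q i = trans (coeff-+ (scale a q) _ i) (+-congʳ (coeff-scale a q i))

  +ᴾ-cong : ∀ p p′ q q′ → p ≈ᴾ p′ → q ≈ᴾ q′ → p +ᴾ q ≈ᴾ p′ +ᴾ q′
  +ᴾ-cong p p′ q q′ p≈p′ q≈q′ i = begin
    coeff (p +ᴾ q) i         ≈⟨ coeff-+ p q i ⟩
    coeff p i + coeff q i    ≈⟨ +-cong (p≈p′ i) (q≈q′ i) ⟩
    coeff p′ i + coeff q′ i  ≈⟨ coeff-+ p′ q′ i ⟨
    coeff (p′ +ᴾ q′) i       ∎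

  +ᴾ-assoc : ∀ p q r → (p +ᴾ q) +ᴾ r ≈ᴾ p +ᴾ (q +ᴾ r)
  +ᴾ-assoc p q r i = begin
    coeff ((p +ᴾ q) +ᴾ r) i                  ≈⟨ coeff-+ (p +ᴾ q) r i ⟩
    coeff (p +ᴾ q) i + coeff r i             ≈⟨ +-congʳ (coeff-+ p q i) ⟩
    coeff p i + coeff q i + coeff r i        ≈⟨ +-assoc _ _ _ ⟩
    coeff p i + (coeff q i + coeff r i)      ≈⟨ +-congˡ (coeff-+ q r i) ⟨
    coeff p i + coeff (q +ᴾ r) i             ≈⟨ coeff-+ p (q +ᴾ r) i ⟨
    coeff (p +ᴾ (q +ᴾ r)) i                  ∎

  +ᴾ-comm : ∀ p q → p +ᴾ q ≈ᴾ q +ᴾ p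
  +ᴾ-comm p q i = trans (coeff-+ p q i) (trans (+-comm _ _) (sym (coeff-+ q p i)))

  *ᴾ-congˡ : ∀ p q q′ → q ≈ᴾ q′ → p *ᴾ q ≈ᴾ p *ᴾ q′
  *ᴾ-congˡ []      q q′ q≈q′ i = refl
  *ᴾ-congˡ (a ∷ p) q q′ q≈q′ i = begin
    coeff ((a ∷ p) *ᴾ q) i                        ≈⟨ coeff-∷-* a p q i ⟩
    a * coeff q i + coeff (shift (p *ᴾ q)) i      ≈⟨ +-cong (*-congˡ (q≈q′ i)) (coeff-shift-cong (p *ᴾ q) (p *ᴾ q′) (*ᴾ-congˡ p q q′ q≈q′) i) ⟩
    a * coeff q′ i + coeff (shift (p *ᴾ q′)) i    ≈⟨ coeff-∷-* a p q′ i ⟨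
    coeff ((a ∷ p) *ᴾ q′) i                       ∎

  *ᴾ-zeroʳ : ∀ p → p *ᴾ [] ≈ᴾ []
  *ᴾ-zeroʳ []      i       = refl
  *ᴾ-zeroʳ (a ∷ p) zero    = refl
  *ᴾ-zeroʳ (a ∷ p) (suc i) = *ᴾ-zeroʳ p i

  -- The counterpart of `coeff-∷-*` for the right factor. Since `_*ᴾ_` recurses on the left one,
  -- this is the content of commutativity.
  coeff-*-∷ : ∀ p b q i → coeff (p *ᴾ (b ∷ q)) i ≈ b * coeff p i + coeff (shift (p *ᴾ q)) i
  coeff-*-∷ []      b q zero    = sym (trans (+-identityʳ _) (zeroʳ b))
  coeff-*-∷ []      b q (suc i) = sym (trans (+-identityʳ _) (zeroʳ b))
  coeff-*-∷ (a ∷ p) b q zero    = +-congʳ (*-comm a b)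
  coeff-*-∷ (a ∷ p) b q (suc i) = begin
    coeff (scale a q +ᴾ p *ᴾ (b ∷ q)) i                              ≈⟨ coeff-+ (scale a q) (p *ᴾ (b ∷ q)) i ⟩
    coeff (scale a q) i + coeff (p *ᴾ (b ∷ q)) i                     ≈⟨ +-congˡ (coeff-*-∷ p b q i) ⟩
    coeff (scale a q) i + (b * coeff p i + coeff (shift (p *ᴾ q)) i) ≈⟨ solve 3 (λ x y z → x :+ (y :+ z) := y :+ (x :+ z)) refl _ _ _ ⟩
    b * coeff p i + (coeff (scale a q) i + coeff (shift (p *ᴾ q)) i) ≈⟨ +-congˡ (coeff-+ (scale a q) (shift (p *ᴾ q)) i) ⟨
    b * coeff p i + coeff ((a ∷ p) *ᴾ q) i                           ∎

  *ᴾ-comm : ∀ p q → p *ᴾ q ≈ᴾ q *ᴾ p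
  *ᴾ-comm []      q i = sym (*ᴾ-zeroʳ q i)
  *ᴾ-comm (a ∷ p) q i = begin
    coeff ((a ∷ p) *ᴾ q) i                      ≈⟨ coeff-∷-* a p q i ⟩
    a * coeff q i + coeff (shift (p *ᴾ q)) i    ≈⟨ +-congˡ (coeff-shift-cong (p *ᴾ q) (q *ᴾ p) (*ᴾ-comm p q) i) ⟩
    a * coeff q i + coeff (shift (q *ᴾ p)) i    ≈⟨ coeff-*-∷ q a p i ⟨
    coeff (q *ᴾ (a ∷ p)) i                      ∎

  -- Equal polynomials may be lists of different lengths, so a recursion on the two left factors
  -- gets no grip; commutativity moves them to the right.
  *ᴾ-congʳ : ∀ q p p′ → p ≈ᴾ p′ → p *ᴾ q ≈ᴾ p′ *ᴾ q
  *ᴾ-congʳ q p p′ p≈p′ i = trans (*ᴾ-comm p q i) (trans (*ᴾ-congˡ q p p′ p≈p′ i) (*ᴾ-comm q p′ i))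

  *ᴾ-distribˡ : ∀ p q r → p *ᴾ (q +ᴾ r) ≈ᴾ p *ᴾ q +ᴾ p *ᴾ r
  *ᴾ-distribˡ []      q r i = refl
  *ᴾ-distribˡ (a ∷ p) q r i = begin
    coeff ((a ∷ p) *ᴾ (q +ᴾ r)) i
      ≈⟨ coeff-∷-* a p (q +ᴾ r) i ⟩
    a * coeff (q +ᴾ r) i + coeff (shift (p *ᴾ (q +ᴾ r))) i
      ≈⟨ +-cong (*-congˡ (coeff-+ q r i))
                (trans (coeff-shift-cong (p *ᴾ (q +ᴾ r)) (p *ᴾ q +ᴾ p *ᴾ r) (*ᴾ-distribˡ p q r) i) (coeff-shift-+ (p *ᴾ q) (p *ᴾ r) i)) ⟩
    a * (coeff q i + coeff r i) + (coeff (shift (p *ᴾ q)) i + coeff (shift (p *ᴾ r)) i)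
      ≈⟨ solve 5 (λ a x y u v → a :* (x :+ y) :+ (u :+ v) := (a :* x :+ u) :+ (a :* y :+ v)) refl _ _ _ _ _ ⟩
    (a * coeff q i + coeff (shift (p *ᴾ q)) i) + (a * coeff r i + coeff (shift (p *ᴾ r)) i)
      ≈⟨ +-cong (coeff-∷-* a p q i) (coeff-∷-* a p r i) ⟨
    coeff ((a ∷ p) *ᴾ q) i + coeff ((a ∷ p) *ᴾ r) i
      ≈⟨ coeff-+ ((a ∷ p) *ᴾ q) ((a ∷ p) *ᴾ r) i ⟨
    coeff ((a ∷ p) *ᴾ q +ᴾ (a ∷ p) *ᴾ r) i ∎

  *ᴾ-distribʳ : ∀ p q r → (q +ᴾ r) *ᴾ p ≈ᴾ q *ᴾ p +ᴾ r *ᴾ p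
  *ᴾ-distribʳ p q r i = begin
    coeff ((q +ᴾ r) *ᴾ p) i     ≈⟨ *ᴾ-comm (q +ᴾ r) p i ⟩
    coeff (p *ᴾ (q +ᴾ r)) i     ≈⟨ *ᴾ-distribˡ p q r i ⟩
    coeff (p *ᴾ q +ᴾ p *ᴾ r) i  ≈⟨ +ᴾ-cong (p *ᴾ q) (q *ᴾ p) (p *ᴾ r) (r *ᴾ p) (*ᴾ-comm p q) (*ᴾ-comm p r) i ⟩
    coeff (q *ᴾ p +ᴾ r *ᴾ p) i  ∎

  scale-* : ∀ a p q → scale a p *ᴾ q ≈ᴾ scale a (p *ᴾ q)
  scale-* a []      q i = refl
  scale-* a (b ∷ p) q i = begin
    coeff (scale a (b ∷ p) *ᴾ q) i
      ≈⟨ coeff-∷-* (a * b) (scale a p) q i ⟩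
    a * b * coeff q i + coeff (shift (scale a p *ᴾ q)) i
      ≈⟨ +-congˡ (trans (coeff-shift-cong (scale a p *ᴾ q) (scale a (p *ᴾ q)) (scale-* a p q) i) (coeff-shift-scale a (p *ᴾ q) i)) ⟩
    a * b * coeff q i + a * coeff (shift (p *ᴾ q)) i
      ≈⟨ solve 4 (λ a b x y → a :* b :* x :+ a :* y := a :* (b :* x :+ y)) refl _ _ _ _ ⟩
    a * (b * coeff q i + coeff (shift (p *ᴾ q)) i)
      ≈⟨ *-congˡ (coeff-∷-* b p q i) ⟨
    a * coeff ((b ∷ p) *ᴾ q) i
      ≈⟨ coeff-scale a ((b ∷ p) *ᴾ q) i ⟨
    coeff (scale a ((b ∷ p) *ᴾ q)) i ∎

  shift-* : ∀ p q → shift p *ᴾ q ≈ᴾ shift (p *ᴾ q)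
  shift-* p q i = trans (coeff-∷-* 0# p q i) (trans (+-congʳ (zeroˡ _)) (+-identityˡ _))

  *ᴾ-assoc : ∀ p q r → (p *ᴾ q) *ᴾ r ≈ᴾ p *ᴾ (q *ᴾ r)
  *ᴾ-assoc []      q r i = refl
  *ᴾ-assoc (a ∷ p) q r i = begin
    coeff ((scale a q +ᴾ shift (p *ᴾ q)) *ᴾ r) i
      ≈⟨ *ᴾ-distribʳ r (scale a q) (shift (p *ᴾ q)) i ⟩
    coeff (scale a q *ᴾ r +ᴾ shift (p *ᴾ q) *ᴾ r) i
      ≈⟨ +ᴾ-cong (scale a q *ᴾ r) (scale a (q *ᴾ r)) (shift (p *ᴾ q) *ᴾ r) (shift (p *ᴾ (q *ᴾ r))) (scale-* a q r)
           (λ j → trans (shift-* (p *ᴾ q) r j) (coeff-shift-cong ((p *ᴾ q) *ᴾ r) (p *ᴾ (q *ᴾ r)) (*ᴾ-assoc p q r) j)) i ⟩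
    coeff (scale a (q *ᴾ r) +ᴾ shift (p *ᴾ (q *ᴾ r))) i ∎

  constant-* : ∀ a p → constant a *ᴾ p ≈ᴾ scale a p
  constant-* a p zero    = trans (coeff-+ (scale a p) (0# ∷ []) zero) (+-identityʳ _)
  constant-* a p (suc i) = trans (coeff-+ (scale a p) (0# ∷ []) (suc i)) (+-identityʳ _)

  *ᴾ-identityˡ : ∀ p → constant 1# *ᴾ p ≈ᴾ p
  *ᴾ-identityˡ p i = trans (constant-* 1# p i) (trans (coeff-scale 1# p i) (*-identityˡ _))

  X-* : ∀ p → X *ᴾ p ≈ᴾ shift p
  X-* p i = trans (shift-* (constant 1#) p i) (coeff-shift-cong (constant 1# *ᴾ p) p (*ᴾ-identityˡ p) i)

  -- Its operations are literally those of `polyRing`, so determinants over the two are the same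
  -- terms and the general determinant results apply to `charpoly`.
  polyCommutativeRing : CommutativeRing c ℓ
  polyCommutativeRing = record
    { Carrier = Poly
    ; _≈_     = _≈ᴾ_
    ; _+_     = _+ᴾ_
    ; _*_     = _*ᴾ_
    ; -_      = P.-_
    ; 0#      = []
    ; 1#      = constant 1#
    ; isCommutativeRing = record
      { isRing = record
        { +-isAbelianGroup = record
          { isGroup = record
            { isMonoid = record
              { isSemigroup = record
                { isMagma = record
                  { isEquivalence = record
                    { refl  = λ i → refl
                    ; sym   = λ p≈q i → sym (p≈q i)
                    ; trans = λ p≈q q≈r i → trans (p≈q i) (q≈r i)
                    }
                  ; ∙-cong = λ {p} {p′} {q} {q′} → +ᴾ-cong p p′ q q′
                  }
                ; assoc = +ᴾ-assoc
                }
              ; identity = (λ p i → refl) , (λ p i → trans (coeff-+ p [] i) (+-identityʳ _))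
              }
            ; inverse = (λ p i → trans (coeff-+ (P.- p) p i) (trans (+-congʳ (coeff-neg p i)) (-‿inverseˡ _)))
                      , (λ p i → trans (coeff-+ p (P.- p) i) (trans (+-congˡ (coeff-neg p i)) (-‿inverseʳ _)))
            ; ⁻¹-cong = λ {p} {q} p≈q i → trans (coeff-neg p i) (trans (-‿cong (p≈q i)) (sym (coeff-neg q i)))
            }
          ; comm = +ᴾ-comm
          }
        ; *-cong = λ {p} {p′} {q} {q′} p≈p′ q≈q′ i →
            trans (*ᴾ-congʳ q p p′ p≈p′ i) (*ᴾ-congˡ p′ q q′ q≈q′ i)
        ; *-assoc = *ᴾ-assoc
        ; *-identity = *ᴾ-identityˡ , λ p i → trans (*ᴾ-comm p (constant 1#) i) (*ᴾ-identityˡ p i)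
        ; distrib = *ᴾ-distribˡ , *ᴾ-distribʳ
        }
      ; *-comm = *ᴾ-comm
      }
    }

  -- An upper bound in place of a degree, as nothing decides whether a coefficient is zero. It is a
  -- record so that `d` and `p` can be inferred from a proof, whereas `coeff` cannot be inverted by
  -- unification.
  record Degree≤ (d : ℕ) (p : Poly) : Set ℓ where
    field vanish : ∀ {i} → d < i → coeff p i ≈ 0#
  open Degree≤ public

  record Monic (d : ℕ) (p : Poly) : Set ℓ where
    field
      degree≤ : Degree≤ d p
      leading : coeff p d ≈ 1#
  open Monic public

  degree≤-mono : ∀ {d e p} → d ≤ e → Degree≤ d p → Degree≤ e p
  degree≤-mono d≤e dp .vanish e<i = vanish dp (ℕ.≤-<-trans d≤e e<i)

  degree≤-[] : ∀ {d} → Degree≤ d []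
  degree≤-[] .vanish _ = refl

  degree≤-constant : ∀ a → Degree≤ 0 (constant a)
  degree≤-constant a .vanish (s≤s _) = refl

  degree≤-+ : ∀ {d p q} → Degree≤ d p → Degree≤ d q → Degree≤ d (p +ᴾ q)
  degree≤-+ {p = p} {q} dp dq .vanish {i} d<i =
    trans (coeff-+ p q i) (trans (+-cong (vanish dp d<i) (vanish dq d<i)) (+-identityˡ _))

  degree≤-neg : ∀ {d p} → Degree≤ d p → Degree≤ d (P.- p)
  degree≤-neg {p = p} dp .vanish {i} d<i =
    trans (coeff-neg p i) (trans (-‿cong (vanish dp d<i)) (RingProperties.-0#≈0# ring))

  zero-* : ∀ p q → p ≈ᴾ [] → p *ᴾ q ≈ᴾ []
  zero-* p q p≈0 = *ᴾ-congʳ q p [] p≈0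

  degree≤-* : ∀ {d e} p {q} → Degree≤ d p → Degree≤ e q → Degree≤ (d ℕ.+ e) (p *ᴾ q)
  degree≤-* []      dp dq = degree≤-[]
  -- Here the tail `p` need not be the empty list; only its coefficients are known to vanish.
  degree≤-* {zero} {e} (a ∷ p) {q} dp dq .vanish {suc i} e<i = begin
    coeff ((a ∷ p) *ᴾ q) (suc i)              ≈⟨ coeff-∷-* a p q (suc i) ⟩
    a * coeff q (suc i) + coeff (p *ᴾ q) i    ≈⟨ +-cong (*-congˡ (vanish dq e<i)) (zero-* p q (λ j → vanish dp z<s) i) ⟩
    a * 0# + 0#                               ≈⟨ trans (+-identityʳ _) (zeroʳ a) ⟩
    0#                                        ∎
  degree≤-* {suc d} {e} (a ∷ p) {q} dp dq .vanish {suc i} d<i = begin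
    coeff ((a ∷ p) *ᴾ q) (suc i)              ≈⟨ coeff-∷-* a p q (suc i) ⟩
    a * coeff q (suc i) + coeff (p *ᴾ q) i    ≈⟨ +-cong (*-congˡ (vanish dq (ℕ.≤-<-trans (ℕ.m≤n+m e (suc d)) d<i)))
                                                   (vanish (degree≤-* p {q} tail-degree dq) (s<s⁻¹ d<i)) ⟩
    a * 0# + 0#                               ≈⟨ trans (+-identityʳ _) (zeroʳ a) ⟩
    0#                                        ∎
    where
    tail-degree : Degree≤ d p
    tail-degree .vanish d<j = vanish dp (s≤s d<j)

  leading-* : ∀ {d e} p {q} → Degree≤ d p → Degree≤ e q →
              coeff (p *ᴾ q) (d ℕ.+ e) ≈ coeff p d * coeff q e
  leading-* []      dp dq = sym (zeroˡ _)
  leading-* {zero} {e} (a ∷ p) {q} dp dq = begin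
    coeff ((a ∷ p) *ᴾ q) e                      ≈⟨ coeff-∷-* a p q e ⟩
    a * coeff q e + coeff (shift (p *ᴾ q)) e    ≈⟨ +-congˡ (trans (coeff-shift-cong (p *ᴾ q) [] (zero-* p q λ j → vanish dp z<s) e) (coeff-0∷[] e)) ⟩
    a * coeff q e + 0#                          ≈⟨ +-identityʳ _ ⟩
    a * coeff q e                               ∎
    where
    coeff-0∷[] : ∀ i → coeff (shift []) i ≈ 0#
    coeff-0∷[] zero    = refl
    coeff-0∷[] (suc i) = refl
  leading-* {suc d} {e} (a ∷ p) {q} dp dq = begin
    coeff ((a ∷ p) *ᴾ q) (suc d ℕ.+ e)                       ≈⟨ coeff-∷-* a p q (suc d ℕ.+ e) ⟩
    a * coeff q (suc d ℕ.+ e) + coeff (p *ᴾ q) (d ℕ.+ e)     ≈⟨ +-cong (*-congˡ (vanish dq (s≤s (ℕ.m≤n+m e d)))) (leading-* p {q} tail-degree dq) ⟩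
    a * 0# + coeff p d * coeff q e                           ≈⟨ trans (+-congʳ (zeroʳ a)) (+-identityˡ _) ⟩
    coeff p d * coeff q e                                    ∎
    where
    tail-degree : Degree≤ d p
    tail-degree .vanish d<j = vanish dp (s≤s d<j)

  monic-1 : Monic 0 (constant 1#)
  monic-1 = record { degree≤ = degree≤-constant 1# ; leading = refl }

  monic-X : Monic 1 X
  monic-X .degree≤ .vanish (s≤s (s≤s _)) = refl
  monic-X .leading = refl

  monic-* : ∀ {d e p q} → Monic d p → Monic e q → Monic (d ℕ.+ e) (p *ᴾ q)
  monic-* {p = p} mp mq = record
    { degree≤ = degree≤-* p (degree≤ mp) (degree≤ mq)
    ; leading = trans (leading-* p (degree≤ mp) (degree≤ mq)) (trans (*-cong (leading mp) (leading mq)) (*-identityˡ _))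
    }

  monic-+ : ∀ {d p q} → Monic (suc d) p → Degree≤ d q → Monic (suc d) (p +ᴾ q)
  monic-+ {d} {p} {q} mp dq = record
    { degree≤ = degree≤-+ {p = p} (degree≤ mp) (degree≤-mono (ℕ.n≤1+n d) dq)
    ; leading = trans (coeff-+ p q (suc d)) (trans (+-cong (leading mp) (vanish dq ℕ.≤-refl)) (+-identityʳ _))
    }

  private module Pᴿ = CommutativeRing polyCommutativeRing

  -- The top nonzero coefficient of `q` cannot be located, so a bound on `q` is lowered instead,
  -- starting from its length. If `q` has degree at most `e`, the coefficient of the product at
  -- `d + e` is that of `q` at `e`, and hence zero.
  monic-nonZeroDivisor : ∀ {d p} → Monic d p → ∀ q → p *ᴾ q ≈ᴾ [] → q ≈ᴾ []
  monic-nonZeroDivisor {d} {p} mp q pq≈0 = descend (length q) (beyond-length q)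
    where
    beyond-length : ∀ q {i} → length q ≤ i → coeff q i ≈ 0#
    beyond-length []      _         = refl
    beyond-length (a ∷ q) (s≤s l≤i) = beyond-length q l≤i

    descend : ∀ e → (∀ {i} → e ≤ i → coeff q i ≈ 0#) → q ≈ᴾ []
    descend zero    vanishes i = vanishes z≤n
    descend (suc e) vanishes   = descend e λ e≤i → from-e (ℕ.m≤n⇒m<n∨m≡n e≤i)
      where
      from-e : ∀ {i} → e < i ⊎ e ≡ i → coeff q i ≈ 0#
      from-e (inj₁ e<i)    = vanishes e<i
      from-e (inj₂ ≡.refl) = begin
        coeff q e                   ≈⟨ *-identityˡ _ ⟨
        1# * coeff q e              ≈⟨ *-congʳ (leading mp) ⟨
        coeff p d * coeff q e       ≈⟨ leading-* p (degree≤ mp) (record { vanish = vanishes }) ⟨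
        coeff (p *ᴾ q) (d ℕ.+ e)    ≈⟨ pq≈0 (d ℕ.+ e) ⟩
        0#                          ∎

  monic-cancelˡ : ∀ {d p} → Monic d p → ∀ q r → p *ᴾ q ≈ᴾ p *ᴾ r → q ≈ᴾ r
  monic-cancelˡ {p = p} mp q r pq≈pr = x∙y⁻¹≈ε⇒x≈y q r
    (monic-nonZeroDivisor mp (q Pᴿ.- r) λ i → trans (x[y-z]≈xy-xz p q r i) (x≈y⇒x∙y⁻¹≈ε {p *ᴾ q} {p *ᴾ r} pq≈pr i))
    where
    open RingProperties Pᴿ.ring using (x[y-z]≈xy-xz)
    open GroupProperties Pᴿ.+-group using (x∙y⁻¹≈ε⇒x≈y; x≈y⇒x∙y⁻¹≈ε)

  open Determinant polyRing
  open RawSemiringDefs P.rawSemiring using (sum; _^_)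

  degree≤-sum : ∀ {d n} {t : Fin n → Poly} → (∀ j → Degree≤ d (t j)) → Degree≤ d (sum t)
  degree≤-sum {n = zero}  dt = degree≤-[]
  degree≤-sum {n = suc n} {t} dt = degree≤-+ {p = t zero} (dt zero) (degree≤-sum (dt ∘ suc))

  degree≤-sign : ∀ i → Degree≤ 0 ((P.- P.1#) ^ i)
  degree≤-sign zero    = degree≤-constant 1#
  degree≤-sign (suc i) = degree≤-* (P.- P.1#) (degree≤-neg {p = P.1#} (degree≤-constant 1#)) (degree≤-sign i)

  degree≤-det : ∀ {d n} {M : Matrix Poly n} → (∀ p q → Degree≤ d (M p q)) → Degree≤ (n ℕ.* d) (det M)
  degree≤-det {n = zero}  dM = degree≤-constant 1#
  degree≤-det {n = suc n} {M} dM = degree≤-sum λ j → degree≤-* ((P.- P.1#) ^ toℕ j) (degree≤-sign (toℕ j))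
    (degree≤-* (M zero j) (dM zero j) (degree≤-det λ p q → dM (suc p) (punchIn j q)))

  -- In the expansion along the first row only the diagonal entry reaches the top degree. Every
  -- other term has an off-diagonal factor, which loses one degree; its minor may still contain
  -- diagonal entries, so for the minor the cruder bound `suc d` per row is taken.
  monic-det : ∀ {d n} {M : Matrix Poly n} → (∀ p → Monic (suc d) (M p p)) →
              (∀ p q → p ≢ q → Degree≤ d (M p q)) → Monic (n ℕ.* suc d) (det M)
  monic-det {n = zero}  diag off = monic-1
  monic-det {d} {suc n} {M} diag off = monic-+
    -- The factor `monic-1` accounts for the sign of the first term, the zeroth power of minus one.
    (monic-* monic-1 (monic-* (diag zero) (monic-det (diag ∘ suc) λ p q p≢q → off (suc p) (suc q) (p≢q ∘ suc-injective))))
    (degree≤-sum λ j → degree≤-* ((P.- P.1#) ^ suc (toℕ j)) (degree≤-sign (suc (toℕ j)))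
      (degree≤-* (M zero (suc j)) (off zero (suc j) λ ())
        (degree≤-det λ p q → any (suc p) (punchIn (suc j) q))))
    where
    any : ∀ p q → Degree≤ (suc d) (M p q)
    any p q with p ≟ q
    ... | yes ≡.refl = degree≤ (diag p)
    ... | no  p≢q    = degree≤-mono (ℕ.n≤1+n d) (off p q p≢q)

-- Splitting monic polynomials into linear factors

module Splitting {c ℓ₁ ℓ₂} (K : AlgebraicallyClosedField c ℓ₁ ℓ₂) where
  open AlgebraicallyClosedField K using (commutativeRing; rawRing; root)
  open CommutativeRing commutativeRing hiding (zero; rawRing)
  open RingProperties ring using (-‿distribˡ-*; -0#≈0#)
  open Polynomial rawRing
  open PolynomialProperties commutativeRing
  open RawRing polyRing using () renaming (_≈_ to _≈ᴾ_; -_ to -ᴾ_; 1# to 1ᴾ)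
  open SetoidReasoning setoid

  linear : Carrier → Poly
  linear x = X +ᴾ (-ᴾ constant x)

  coeff-linear-* : ∀ x p i → coeff (linear x *ᴾ p) i ≈ coeff (shift p) i + - (x * coeff p i)
  coeff-linear-* x p i = begin
    coeff (linear x *ᴾ p) i
      ≈⟨ *ᴾ-distribʳ p X (-ᴾ constant x) i ⟩
    coeff (X *ᴾ p +ᴾ (-ᴾ constant x) *ᴾ p) i
      ≈⟨ coeff-+ (X *ᴾ p) _ i ⟩
    coeff (X *ᴾ p) i + coeff (constant (- x) *ᴾ p) i
      ≈⟨ +-cong (X-* p i) (trans (constant-* (- x) p i) (coeff-scale (- x) p i)) ⟩
    coeff (shift p) i + - x * coeff p i
      ≈⟨ +-congˡ (-‿distribˡ-* x _) ⟨
    coeff (shift p) i + - (x * coeff p i) ∎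

  -- Horner's scheme: the values of the successive tails at `x` are the coefficients of the quotient
  -- by X - x. The result is as long as the dividend, so for a nonempty one it ends in a zero.
  quotient : Carrier → Poly → Poly
  quotient x []      = []
  quotient x (a ∷ p) = evaluate p x ∷ quotient x p

  cancel-middle : ∀ a b → 0# + - b + (a + b) ≈ a
  cancel-middle a b = begin
    0# + - b + (a + b)   ≈⟨ +-cong (+-identityˡ _) (+-comm a b) ⟩
    - b + (b + a)        ≈⟨ +-assoc _ _ _ ⟨
    - b + b + a          ≈⟨ +-congʳ (-‿inverseˡ b) ⟩
    0# + a               ≈⟨ +-identityˡ a ⟩
    a                    ∎

  synthetic-division : ∀ x p i →
    coeff p i ≈ coeff (shift (quotient x p)) i + - (x * coeff (quotient x p) i) + coeff (constant (evaluate p x)) i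
  synthetic-division x [] zero = sym (trans (+-identityʳ _) (trans (+-identityˡ _) (trans (-‿cong (zeroʳ x)) -0#≈0#)))
  synthetic-division x [] (suc i) = sym (trans (+-identityʳ _) (trans (+-identityˡ _) (trans (-‿cong (zeroʳ x)) -0#≈0#)))
  synthetic-division x (a ∷ p) zero = sym (cancel-middle a (x * evaluate p x))
  synthetic-division x (a ∷ p) (suc zero) = begin
    coeff p 0                                      ≈⟨ synthetic-division x p 0 ⟩
    0# + - (x * coeff (quotient x p) 0) + evaluate p x ≈⟨ +-congʳ (+-identityˡ _) ⟩
    - (x * coeff (quotient x p) 0) + evaluate p x  ≈⟨ +-comm _ _ ⟩
    evaluate p x + - (x * coeff (quotient x p) 0)  ≈⟨ +-identityʳ _ ⟨
    evaluate p x + - (x * coeff (quotient x p) 0) + 0# ∎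
  synthetic-division x (a ∷ p) (suc (suc i)) = synthetic-division x p (suc i)

  factor : ∀ x p → evaluate p x ≈ 0# → p ≈ᴾ linear x *ᴾ quotient x p
  factor x p px≈0 i = begin
    coeff p i                                              ≈⟨ synthetic-division x p i ⟩
    coeff (shift (quotient x p)) i + - (x * coeff (quotient x p) i) + coeff (constant (evaluate p x)) i
                                                           ≈⟨ +-cong (sym (coeff-linear-* x (quotient x p) i)) (remainder≈0 i) ⟩
    coeff (linear x *ᴾ quotient x p) i + 0#                ≈⟨ +-identityʳ _ ⟩
    coeff (linear x *ᴾ quotient x p) i                     ∎
    where
    remainder≈0 : ∀ i → coeff (constant (evaluate p x)) i ≈ 0#
    remainder≈0 zero    = px≈0
    remainder≈0 (suc i) = refl

  monic : List Carrier → Poly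
  monic p = p ++ 1# ∷ []

  -- The quotient of `a ∷ monic p` with its leading one and its trailing zero removed. Both `root`
  -- and the recursion in `splits` ask for the literal shape `monic`.
  lowerQuotient : Carrier → List Carrier → List Carrier
  lowerQuotient x []      = []
  lowerQuotient x (a ∷ p) = evaluate (monic (a ∷ p)) x ∷ lowerQuotient x p

  quotient-monic : ∀ x a p → quotient x (a ∷ monic p) ≈ᴾ monic (lowerQuotient x p)
  quotient-monic x a []      zero          = trans (+-congˡ (zeroʳ x)) (+-identityʳ 1#)
  quotient-monic x a []      (suc zero)    = refl
  quotient-monic x a []      (suc (suc i)) = refl
  quotient-monic x a (b ∷ p) zero          = refl
  quotient-monic x a (b ∷ p) (suc i)       = quotient-monic x b p i

  length-lowerQuotient : ∀ x p → length (lowerQuotient x p) ≡ length p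
  length-lowerQuotient x []      = ≡.refl
  length-lowerQuotient x (a ∷ p) = ≡.cong suc (length-lowerQuotient x p)

  product : List Carrier → Poly
  product = foldr (λ a p → linear a *ᴾ p) 1ᴾ

  -- The recursion runs on the length, because `lowerQuotient x p` is shorter than `a ∷ p` without
  -- being a part of it.
  splits : ∀ n (p : List Carrier) → length p ≡ n → ∃[ s ] monic p ≈ᴾ product s
  splits zero    []      _       = [] , λ i → refl
  splits (suc n) (a ∷ p) ∣p∣≡n
    with x , px≈0 ← root a p
    with s , q≈ ← splits n (lowerQuotient x p) (≡.trans (length-lowerQuotient x p) (ℕ.suc-injective ∣p∣≡n))
    = x ∷ s , λ i → begin
      coeff (a ∷ monic p) i                              ≈⟨ factor x (a ∷ monic p) px≈0 i ⟩
      coeff (linear x *ᴾ quotient x (a ∷ monic p)) i     ≈⟨ *ᴾ-congˡ (linear x) (quotient x (a ∷ monic p)) (monic (lowerQuotient x p)) (quotient-monic x a p) i ⟩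
      coeff (linear x *ᴾ monic (lowerQuotient x p)) i    ≈⟨ *ᴾ-congˡ (linear x) (monic (lowerQuotient x p)) (product s) q≈ i ⟩
      coeff (linear x *ᴾ product s) i                    ∎

  -- A `Monic` polynomial may carry trailing zeros, and its leading coefficient is one only up to
  -- `_≈_`. Listing its first `n` coefficients afresh gives the literal shape that `splits` expects.
  coeff-applyUpTo : ∀ n (f : ℕ → Carrier) → f n ≈ 1# → (∀ {i} → n < i → f i ≈ 0#) →
                    ∀ i → f i ≈ coeff (monic (applyUpTo f n)) i
  coeff-applyUpTo zero    f fn≈1 f≈0 zero    = fn≈1
  coeff-applyUpTo zero    f fn≈1 f≈0 (suc i) = f≈0 z<s
  coeff-applyUpTo (suc n) f fn≈1 f≈0 zero    = refl
  coeff-applyUpTo (suc n) f fn≈1 f≈0 (suc i) = coeff-applyUpTo n (f ∘ suc) fn≈1 (f≈0 ∘ s≤s) i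

  monic-splits : ∀ {n p} → Monic n p → ∃[ s ] p ≈ᴾ product s
  monic-splits {n} {p} mp
    with s , eq ← splits n (applyUpTo (coeff p) n) (length-applyUpTo (coeff p) n)
    = s , λ i → trans (coeff-applyUpTo n (coeff p) (leading mp) (vanish (degree≤ mp)) i) (eq i)

-- Vertex degrees in the cones and in the pasted graphs

module ℕ-sum where
  open CommutativeMonoidSum ℕ.+-0-commutativeMonoid public
  open SumProperties ℕ.+-0-commutativeMonoid public

open ℕ-sum using (sum-cong-≗; sum-single; sum-single′; sum-⊎; sum-×; sum-remove; sum-permute; ∑-distrib-+) renaming (sum to sumℕ)
open ≡ using (refl; sym; trans; cong; cong₂; module ≡-Reasoning)

bit : Bool → ℕ
bit b = if b then 1 else 0

∣tabulate∣≡sumℕ : ∀ {n} (f : Fin n → Bool) → ∣ tabulate f ∣ ≡ sumℕ (bit ∘ f)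
∣tabulate∣≡sumℕ {zero}  f = refl
∣tabulate∣≡sumℕ {suc n} f with f zero
... | true  = cong suc (∣tabulate∣≡sumℕ (f ∘ suc))
... | false = ∣tabulate∣≡sumℕ (f ∘ suc)

sum-bit≤ : ∀ {n} (f : Fin n → Bool) → sumℕ (bit ∘ f) ≤ n
sum-bit≤ {zero}  f = z≤n
sum-bit≤ {suc n} f with f zero
... | true  = s≤s (sum-bit≤ (f ∘ suc))
... | false = ℕ.m≤n⇒m≤1+n (sum-bit≤ (f ∘ suc))

sum-bit≡⇒true : ∀ {n} (f : Fin n → Bool) → sumℕ (bit ∘ f) ≡ n → ∀ i → f i ≡ true
sum-bit≡⇒true {suc n} f eq i with f zero in f0
sum-bit≡⇒true f eq zero    | true  = f0
sum-bit≡⇒true f eq (suc i) | true  = sum-bit≡⇒true (f ∘ suc) (ℕ.suc-injective eq) i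
sum-bit≡⇒true f eq i       | false = contradiction (≡.subst (_≤ _) eq (sum-bit≤ (f ∘ suc))) ℕ.1+n≰n

degree-sum : ∀ {n} (G : Graph n) p → degree G p ≡ sumℕ (bit ∘ adj G p)
degree-sum G p = ∣tabulate∣≡sumℕ (adj G p)

-- Without the loop position at `u`, which contributes nothing, the degree is a sum of `n` bits
-- equal to `n`, so every bit is set.
dominating : ∀ {n} (G : Graph (suc n)) {u} → degree G u ≡ n → ∀ {y} → u ≢ y → adj G u y ≡ true
dominating {n} G {u} deg {y} u≢y = trans (cong (adj G u) (sym (punchIn-punchOut u≢y)))
  (sum-bit≡⇒true (adj G u ∘ punchIn u) total (punchOut u≢y))
  where
  open ≡-Reasoning
  total : sumℕ (bit ∘ adj G u ∘ punchIn u) ≡ n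
  total = begin
    sumℕ (bit ∘ adj G u ∘ punchIn u)                        ≡⟨ cong (λ b → bit b ℕ.+ sumℕ (bit ∘ adj G u ∘ punchIn u)) (adj-irrefl G u) ⟨
    bit (adj G u u) ℕ.+ sumℕ (bit ∘ adj G u ∘ punchIn u)    ≡⟨ sum-remove {i = u} (bit ∘ adj G u) ⟨
    sumℕ (bit ∘ adj G u)                                    ≡⟨ degree-sum G u ⟨
    degree G u                                             ≡⟨ deg ⟩
    n                                                      ∎

incident : ∀ {n k} {F : Graph n} → (Fin k → Edge F) → Fin n → Fin k → Bool
incident E p i = does (p ≟ src (E i)) ∨ does (p ≟ tgt (E i))

-- Under these hypotheses `H` is the join of an edge with an `r`-regular graph on `l` vertices. With
-- the order written as `2 + l`, the expression `m ∸ 2` in the definitions reduces to `l`.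
module RegularCone {l r} {H : Graph (2 ℕ.+ l)} (e : Edge H)
                   (src-dominating : degree H (src e) ≡ suc l)
                   (tgt-dominating : degree H (tgt e) ≡ suc l)
                   (regular : Regular (removeEnds e) r) where

  interior≢src : ∀ w → src e ≢ interior e w
  interior≢src w = punchInᵢ≢i (src e) _ ∘ sym

  interior≢tgt : ∀ w → tgt e ≢ interior e w
  interior≢tgt w eq = punchInᵢ≢i (punchOut (src≢tgt e)) w
    (sym (punchIn-injective (src e) _ _ (trans (punchIn-punchOut (src≢tgt e)) eq)))

  src~interior : ∀ w → adj H (src e) (interior e w) ≡ true
  src~interior w = dominating H src-dominating (interior≢src w)

  tgt~interior : ∀ w → adj H (tgt e) (interior e w) ≡ true
  tgt~interior w = dominating H tgt-dominating (interior≢tgt w)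

  -- Built from `insert` so that position zero computes to `src e` and the positions after the first
  -- two compute to `interior e`; only position one needs the propositional `endsFirst-tgt`.
  endsFirst : Permutation (2 ℕ.+ l) (2 ℕ.+ l)
  endsFirst = insert zero (src e) (insert zero (punchOut (src≢tgt e)) idₚ)

  endsFirst-tgt : endsFirst ⟨$⟩ʳ suc zero ≡ tgt e
  endsFirst-tgt = punchIn-punchOut (src≢tgt e)

  degree-interior : ∀ w → degree H (interior e w) ≡ 2 ℕ.+ r
  degree-interior w = begin
    degree H (interior e w)
      ≡⟨ degree-sum H (interior e w) ⟩
    sumℕ (bit ∘ adj H (interior e w))
      ≡⟨ sum-permute (bit ∘ adj H (interior e w)) endsFirst ⟩
    bit (adj H (interior e w) (src e)) ℕ.+ (bit (adj H (interior e w) (endsFirst ⟨$⟩ʳ suc zero)) ℕ.+ sumℕ (bit ∘ adj (removeEnds e) w))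
      ≡⟨ cong₂ (λ b c → bit b ℕ.+ (bit c ℕ.+ sumℕ (bit ∘ adj (removeEnds e) w)))
           (trans (adj-sym H _ _) (src~interior w))
           (trans (cong (adj H (interior e w)) endsFirst-tgt) (trans (adj-sym H _ _) (tgt~interior w))) ⟩
    2 ℕ.+ sumℕ (bit ∘ adj (removeEnds e) w)
      ≡⟨ cong (2 ℕ.+_) (trans (sym (degree-sum (removeEnds e) w)) (regular w)) ⟩
    2 ℕ.+ r ∎
    where open ≡-Reasoning

  module _ {n k} {F : Graph n} (E : Fin k → Edge F) where
    open Pocket E e

    private G = pocketGraph E e

    attached≡incident : ∀ p i w → attached p i w ≡ incident E p i
    attached≡incident p i w = cong₂ _∨_
      (trans (cong (does (p ≟ src (E i)) ∧_) (src~interior w)) (∧-identityʳ _))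
      (trans (cong (does (p ≟ tgt (E i)) ∧_) (tgt~interior w)) (∧-identityʳ _))

    vertex-join : ∀ s → vertex (join n (k ℕ.* l) s) ≡ map₂ (remQuot l) s
    vertex-join s = cong (map₂ (remQuot l)) (splitAt-join n (k ℕ.* l) s)

    adj-join : ∀ s t → adj G (join n _ s) (join n _ t) ≡ adjV (map₂ (remQuot l) s) (map₂ (remQuot l) t)
    adj-join s t = cong₂ adjV (vertex-join s) (vertex-join t)

    degree-join : ∀ s → degree G (join n _ s) ≡
      sumℕ (λ q → bit (adjV (map₂ (remQuot l) s) (inj₁ q))) ℕ.+
      sumℕ (λ j → sumℕ (λ v → bit (adjV (map₂ (remQuot l) s) (inj₂ (j , v)))))
    degree-join s = begin
      degree G (join n _ s)
        ≡⟨ degree-sum G (join n _ s) ⟩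
      sumℕ (λ y → bit (adjV (vertex (join n _ s)) (vertex y)))
        ≡⟨ cong (λ a → sumℕ (λ y → bit (adjV a (vertex y)))) (vertex-join s) ⟩
      sumℕ (λ y → bit (adjV a (vertex y)))
        ≡⟨ sum-⊎ n (λ t → bit (adjV a (map₂ (remQuot l) t))) ⟩
      sumℕ (λ q → bit (adjV a (inj₁ q))) ℕ.+ sumℕ (λ z → bit (adjV a (inj₂ (remQuot l z))))
        ≡⟨ cong (sumℕ (λ q → bit (adjV a (inj₁ q))) ℕ.+_) (sum-× k l (λ jv → bit (adjV a (inj₂ jv)))) ⟩
      sumℕ (λ q → bit (adjV a (inj₁ q))) ℕ.+ sumℕ (λ j → sumℕ (λ v → bit (adjV a (inj₂ (j , v))))) ∎
      where
      open ≡-Reasoning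
      a = map₂ (remQuot l) s

    degree-base : ∀ p → degree G (p ↑ˡ _) ≡ degree F p ℕ.+ sumℕ (λ j → sumℕ {l} (λ _ → bit (incident E p j)))
    degree-base p = trans (degree-join (inj₁ p)) (cong₂ ℕ._+_ (sym (degree-sum F p))
      (sum-cong-≗ λ j → sum-cong-≗ λ v → cong bit (attached≡incident p j v)))

    sum-incident : ∀ i → sumℕ (λ p → bit (incident E p i)) ≡ 2
    sum-incident i = begin
      sumℕ (λ p → bit (incident E p i))
        ≡⟨ sum-cong-≗ separate ⟩
      sumℕ (λ p → bit (does (p ≟ src (E i))) ℕ.+ bit (does (p ≟ tgt (E i))))
        ≡⟨ ∑-distrib-+ (λ p → bit (does (p ≟ src (E i)))) (λ p → bit (does (p ≟ tgt (E i)))) ⟩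
      sumℕ (λ p → bit (does (p ≟ src (E i)))) ℕ.+ sumℕ (λ p → bit (does (p ≟ tgt (E i))))
        ≡⟨ cong₂ ℕ._+_ (sum-single (const 1) (src (E i))) (sum-single (const 1) (tgt (E i))) ⟩
      2 ∎
      where
      open ≡-Reasoning
      -- The ends of an edge differ, so the disjunction in `incident` may be counted as a sum.
      separate : ∀ p → bit (incident E p i) ≡ bit (does (p ≟ src (E i))) ℕ.+ bit (does (p ≟ tgt (E i)))
      separate p with p ≟ src (E i) | p ≟ tgt (E i)
      ... | yes p≡s | yes p≡t = contradiction (trans (sym p≡s) p≡t) (src≢tgt (E i))
      ... | yes _   | no _    = refl
      ... | no _    | yes _   = refl
      ... | no _    | no _    = refl

    -- Two neighbours are the ends of the edge carrying the copy, `r` lie in the same copy and none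
    -- in another. The total agrees with `degree-interior`, which is why one block `Y` serves both
    -- graphs.
    degree-pocket : ∀ z → degree G (n ↑ʳ z) ≡ 2 ℕ.+ r
    degree-pocket z = trans (degree-join (inj₂ z)) (cong₂ ℕ._+_
      (trans (sum-cong-≗ λ p → cong bit (attached≡incident p i w)) (sum-incident i))
      (trans (sum-cong-≗ own) (sum-single′ (const r) i)))
      where
      i = proj₁ (remQuot {k} l z)
      w = proj₂ (remQuot {k} l z)
      own : ∀ j → sumℕ (λ v → bit (does (i ≟ j) ∧ adj (removeEnds e) w v)) ≡ (if does (i ≟ j) then r else 0)
      own j with i ≟ j
      ... | yes _ = trans (sym (degree-sum (removeEnds e) w)) (regular w)
      ... | no _  = ℕ-sum.sum-replicate-zero l

-- Characteristic matrices in block form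

diagonal-remQuot : ∀ {a} {A : Set a} {z d : A} {k l} (x y : Fin (k ℕ.* l)) →
  diagonal z (const d) x y ≡
  (if does (proj₁ (remQuot {k} l x) ≟ proj₁ (remQuot {k} l y))
   then diagonal z (const d) (proj₂ (remQuot {k} l x)) (proj₂ (remQuot {k} l y)) else z)
diagonal-remQuot {z = z} {d} {k} {l} x y with proj₁ (remQuot {k} l x) ≟ proj₁ (remQuot {k} l y)
... | no  i≢j = diagonal-≢ (const d) (i≢j ∘ cong (proj₁ ∘ remQuot {k} l))
... | yes i≡j with x ≟ y | proj₂ (remQuot {k} l x) ≟ proj₂ (remQuot {k} l y)
...   | yes _   | yes _   = refl
...   | no _    | no _    = refl
...   | yes x≡y | no w≢v  = contradiction (cong (proj₂ ∘ remQuot {k} l) x≡y) w≢v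
...   | no x≢y  | yes w≡v = contradiction
  (trans (sym (combine-remQuot {k} l x)) (trans (cong₂ combine i≡j w≡v) (combine-remQuot {k} l y))) x≢y

-- The integers subtracted in `charpoly` are formed in the field and then made constant polynomials.
-- The block computations see them only through an additive map on the naturals.
IsAdditive : ∀ {c ℓ} (R : CommutativeRing c ℓ) → (ℕ → CommutativeRing.Carrier R) → Set ℓ
IsAdditive R μ = μ 0 ≈ 0# × (∀ a b → μ (a ℕ.+ b) ≈ μ a + μ b)
  where open CommutativeRing R

-- The characteristic matrix of the signless Laplacian, over a ring in which
-- x is the indeterminate and μ n stands for − n.
module CharacteristicMatrix {c ℓ} (R : CommutativeRing c ℓ) (x : CommutativeRing.Carrier R)
                            (μ : ℕ → CommutativeRing.Carrier R) (μ-additive : IsAdditive R μ) where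
  private module R = CommutativeRing R
  open R using (Carrier; _≈_; _+_; _*_; -_; 0#)
  open DeterminantProperties R
  open Determinant R.rawRing
  open RawSemiringDefs (RawRing.rawSemiring R.rawRing) using (_^_)
  private
    module S = SemiringSum R.semiring
    module T = SumProperties R.+-commutativeMonoid
  open RingProperties R.ring using (-‿distribˡ-*)
  open SetoidReasoning R.setoid

  -- Degrees and adjacency are separate data: a diagonal block of `χ` has the adjacency of a
  -- subgraph but keeps the degrees of the whole graph.
  χ′ : ∀ {n} → (Fin n → ℕ) → (Fin n → Fin n → Bool) → Matrix Carrier n
  χ′ d a i j = diagonal 0# (const x) i j + μ (diagonal 0 d i j ℕ.+ bit (a i j))

  χ : ∀ {n} → Graph n → Matrix Carrier n
  χ G = χ′ (degree G) (adj G)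

  -- The summand `0#` is the off-diagonal value of `diagonal`. Keeping it makes off-diagonal entries
  -- of `χ` propositionally equal to this form.
  entry : Bool → Carrier
  entry b = 0# + μ (bit b)

  χ-restrict : ∀ {n a} (G : Graph n) (f : Fin a → Fin n) {d e} → (∀ {i j} → f i ≡ f j → i ≡ j) →
               (∀ i → degree G (f i) ≡ d i) → (∀ i j → adj G (f i) (f j) ≡ e i j) →
               ∀ i j → χ G (f i) (f j) ≡ χ′ d e i j
  χ-restrict G f {d} f-injective deg≡d adj≡e i j = cong₂ (λ y m → y + μ m)
    (diagonal-restrict (const x) (const x) f f-injective (λ _ → refl) i j)
    (cong₂ ℕ._+_ (diagonal-restrict (degree G) d f f-injective deg≡d i j) (cong bit (adj≡e i j)))

  χ-≢ : ∀ {n} (G : Graph n) {i j b} → i ≢ j → adj G i j ≡ b → χ G i j ≡ entry b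
  χ-≢ G {i} {j} i≢j refl = cong₂ (λ y m → y + μ (m ℕ.+ bit (adj G i j)))
    (diagonal-≢ (const x) i≢j) (diagonal-≢ (degree G) i≢j)

  det-join : ∀ {a b} (M : Matrix Carrier (a ℕ.+ b)) (N : Block a b) →
             (∀ s t → M (join a b s) (join a b t) ≈ N s t) → det M ≈ det (flatten N)
  det-join {a} {b} M N M≈N = det-cong λ i j → R.trans
    (R.reflexive (cong₂ M (sym (join-splitAt a b i)) (sym (join-splitAt a b j))))
    (M≈N (splitAt a i) (splitAt a j))

  μ-sum : ∀ {n} (f : Fin n → ℕ) → S.sum (μ ∘ f) ≈ μ (sumℕ f)
  μ-sum {zero}  f = R.sym (proj₁ μ-additive)
  μ-sum {suc n} f = R.trans (R.+-congˡ (μ-sum (f ∘ suc))) (R.sym (proj₂ μ-additive _ _))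

  -- Column `w` contains the diagonal value and `r` further copies of `μ 1`. Hence the all-ones row
  -- is a left eigenvector, with an eigenvalue that depends on `d` and `r` alone.
  column-sum : ∀ {n r} (G : Graph n) → Regular G r → ∀ d w →
               S.sum (λ v → χ′ (const d) (adj G) v w) ≈ x + μ (d ℕ.+ r)
  column-sum {r = r} G reg d w = begin
    S.sum (λ v → χ′ (const d) (adj G) v w)
      ≈⟨ S.∑-distrib-+ (λ v → diagonal 0# (const x) v w) (λ v → μ (f v)) ⟩
    S.sum (λ v → diagonal 0# (const x) v w) + S.sum (λ v → μ (f v))
      ≈⟨ R.+-cong (T.sum-single (const x) w) (μ-sum f) ⟩
    x + μ (sumℕ f)
      ≡⟨ cong (λ m → x + μ m) total ⟩
    x + μ (d ℕ.+ r) ∎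
    where
    f = λ v → diagonal 0 (const d) v w ℕ.+ bit (adj G v w)
    total : sumℕ f ≡ d ℕ.+ r
    total = trans (∑-distrib-+ (λ v → diagonal 0 (const d) v w) (λ v → bit (adj G v w)))
      (cong₂ ℕ._+_ (sum-single (const d) w)
        (trans (sum-cong-≗ λ v → cong bit (adj-sym G v w)) (trans (sym (degree-sum G w)) (reg w))))

  columnSum : ℕ → Carrier
  columnSum r = x + μ (2 ℕ.+ r ℕ.+ r)

  -- This and the next definitions avoid mentioning `H`, so that the two graphs to be compared share
  -- these factors literally. `entry true` stands for -1, so the eliminator adds interior rows with
  -- coefficient one.
  coneEliminator : ∀ l → ℕ → Block 2 l
  coneEliminator l r = eliminator (columnSum r) (λ _ _ → - entry true)

  coneSchur : ℕ → ℕ → Matrix Carrier 2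
  coneSchur l r p q = columnSum r * χ′ (const (suc l)) (λ p q → not (does (p ≟ q))) p q
                    + ((λ _ _ → - entry true) ⊗ (λ (_ : Fin l) _ → entry true)) p q

  module _ {n k} {F : Graph n} (E : Fin k → Edge F) where

    junction : ∀ {l} → Fin n → Fin (k ℕ.* l) → Carrier
    junction {l} p z = entry (incident E p (proj₁ (remQuot {k} l z)))

    -- Each copy pasted onto an edge at `p` adds all its `l` interior vertices to the neighbourhood.
    -- The constant inner sum is left unevaluated to match `degree-base`.
    baseDegree : ℕ → Fin n → ℕ
    baseDegree l p = degree F p ℕ.+ sumℕ (λ j → sumℕ {l} (λ _ → bit (incident E p j)))

    pocketEliminator : ∀ l → ℕ → Block n (k ℕ.* l)
    pocketEliminator l r = eliminator (columnSum r) (λ p z → - junction {l} p z)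

    pocketSchur : ℕ → ℕ → Matrix Carrier n
    pocketSchur l r p q = columnSum r * χ′ (baseDegree l) (adj F) p q
                        + ((λ p z → - junction {l} p z) ⊗ (λ z q → junction {l} q z)) p q

  module ConeDeterminants {l r} {H : Graph (2 ℕ.+ l)} (e : Edge H)
                          (src-dominating : degree H (src e) ≡ suc l)
                          (tgt-dominating : degree H (tgt e) ≡ suc l)
                          (regular : Regular (removeEnds e) r) where
    open RegularCone e src-dominating tgt-dominating regular

    Y : Matrix Carrier l
    Y = χ′ (const (2 ℕ.+ r)) (adj (removeEnds e))

    -- The eigenvector property, in the form of the hypothesis on `J` in `det-bordered`.
    row*Y : ∀ a w → S.sum (λ v → - a * Y v w) ≈ - (columnSum r * a)
    row*Y a w = begin
      S.sum (λ v → - a * Y v w)     ≈⟨ S.*-distribˡ-sum (- a) (λ v → Y v w) ⟨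
      - a * S.sum (λ v → Y v w)     ≈⟨ R.*-congˡ (column-sum (removeEnds e) regular (2 ℕ.+ r) w) ⟩
      - a * columnSum r             ≈⟨ -‿distribˡ-* a _ ⟨
      - (a * columnSum r)           ≈⟨ R.-‿cong (R.*-comm _ _) ⟩
      - (columnSum r * a)           ∎

    endsFirst-injective : ∀ {i j} → endsFirst ⟨$⟩ʳ i ≡ endsFirst ⟨$⟩ʳ j → i ≡ j
    endsFirst-injective eq = trans (sym (inverseˡ endsFirst)) (trans (cong (endsFirst ⟨$⟩ˡ_) eq) (inverseˡ endsFirst))

    end : Fin 2 → Fin (2 ℕ.+ l)
    end p = endsFirst ⟨$⟩ʳ (p ↑ˡ l)

    end-elim : ∀ {P : Fin (2 ℕ.+ l) → Set} → P (src e) → P (tgt e) → ∀ p → P (end p)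
    end-elim     Psrc Ptgt zero       = Psrc
    end-elim {P} Psrc Ptgt (suc zero) = ≡.subst P (sym endsFirst-tgt) Ptgt

    end~end : ∀ p q → adj H (end p) (end q) ≡ not (does (p ≟ q))
    end~end zero       zero       = adj-irrefl H _
    end~end zero       (suc zero) = trans (cong (adj H (src e)) endsFirst-tgt) (isEdge e)
    end~end (suc zero) zero       = trans (adj-sym H _ _) (end~end zero (suc zero))
    end~end (suc zero) (suc zero) = adj-irrefl H _

    end≢interior : ∀ p w → end p ≢ interior e w
    end≢interior p w = end-elim {λ y → y ≢ interior e w} (interior≢src w) (interior≢tgt w) p

    end~interior : ∀ p w → adj H (end p) (interior e w) ≡ true
    end~interior p w = end-elim {λ y → adj H y (interior e w) ≡ true} (src~interior w) (tgt~interior w) p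

    det-cone : det (flatten (coneEliminator l r)) * det (χ H)
             ≈ det (coneSchur l r) * (det (scalar {l} (columnSum r)) * det Y)
    det-cone = begin
      det (flatten (coneEliminator l r)) * det (χ H)
        ≈⟨ R.*-congˡ (det-permute endsFirst (χ H)) ⟨
      det (flatten (coneEliminator l r)) * det (λ i j → χ H (endsFirst ⟨$⟩ʳ i) (endsFirst ⟨$⟩ʳ j))
        ≈⟨ R.*-congˡ (det-join {2} (λ i j → χ H (endsFirst ⟨$⟩ʳ i) (endsFirst ⟨$⟩ʳ j)) (bordered A B C Y) λ s t → R.reflexive (entries s t)) ⟩
      det (flatten (coneEliminator l r)) * det (flatten (bordered A B C Y))
        ≈⟨ det-bordered A B C Y (columnSum r) (λ _ _ → - entry true) (λ _ w → row*Y (entry true) w) ⟩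
      det (coneSchur l r) * (det (scalar {l} (columnSum r)) * det Y) ∎
      where
      A = χ′ (const (suc l)) (λ p q → not (does (p ≟ q)))
      B : Rows 2 l
      B _ _ = entry true
      C : Rows l 2
      C _ _ = entry true

      entries : ∀ s t → χ H (endsFirst ⟨$⟩ʳ join 2 l s) (endsFirst ⟨$⟩ʳ join 2 l t) ≡ bordered A B C Y s t
      entries (inj₁ p) (inj₁ q) = χ-restrict H end (↑ˡ-injective l _ _ ∘ endsFirst-injective)
        (end-elim {λ y → degree H y ≡ suc l} src-dominating tgt-dominating) end~end p q
      entries (inj₁ p) (inj₂ w) = χ-≢ H (end≢interior p w) (end~interior p w)
      entries (inj₂ w) (inj₁ q) = χ-≢ H (end≢interior q w ∘ sym) (trans (adj-sym H _ _) (end~interior q w))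
      entries (inj₂ w) (inj₂ v) = χ-restrict H (interior e) (↑ʳ-injective 2 _ _ ∘ endsFirst-injective)
        degree-interior (λ _ _ → refl) w v

    module _ {n k} {F : Graph n} (E : Fin k → Edge F) where

      open Pocket E e

      private G = pocketGraph E e

      det-pocket : det (flatten (pocketEliminator E l r)) * det (χ G)
                 ≈ det (pocketSchur E l r) * (det (scalar {k ℕ.* l} (columnSum r)) * det Y ^ k)
      det-pocket = begin
        det (flatten (pocketEliminator E l r)) * det (χ G)
          ≈⟨ R.*-congˡ (det-join (χ G) (bordered A B C W) entries) ⟩
        det (flatten (pocketEliminator E l r)) * det (flatten (bordered A B C W))
          ≈⟨ det-bordered A B C W (columnSum r) (λ p z → - junction E {l} p z) JW ⟩
        det (pocketSchur E l r) * (det (scalar {k ℕ.* l} (columnSum r)) * det W)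
          ≈⟨ R.*-congˡ (R.*-congˡ (det-copies k Y)) ⟩
        det (pocketSchur E l r) * (det (scalar {k ℕ.* l} (columnSum r)) * det Y ^ k) ∎
        where
        A = χ′ (baseDegree E l) (adj F)
        B : Rows n (k ℕ.* l)
        B p z = junction E {l} p z
        C : Rows (k ℕ.* l) n
        C z q = junction E {l} q z
        W : Matrix Carrier (k ℕ.* l)
        W y z = copies k Y (remQuot l y) (remQuot l z)

        -- Adjacency of `p` to a copy does not depend on the vertex within it, so row `p` of `J` is
        -- constant on each copy. Only the copy of column `z` meets the block diagonal `W`, and
        -- there `row*Y` applies.
        JW : ∀ p z → ((λ p z → - junction E {l} p z) ⊗ W) p z ≈ - (columnSum r * B p z)
        JW p z = begin
          S.sum (λ y → - junction E {l} p y * W y z)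
            ≈⟨ T.sum-× k l (λ jv → - entry (incident E p (proj₁ jv)) * copies k Y jv (i , w)) ⟩
          S.sum (λ j → S.sum (λ v → - entry (incident E p j) * copies k Y (j , v) (i , w)))
            ≈⟨ S.sum-cong-≋ {k} own ⟩
          S.sum (λ j → if does (j ≟ i) then - (columnSum r * entry (incident E p j)) else 0#)
            ≈⟨ T.sum-single (λ j → - (columnSum r * entry (incident E p j))) i ⟩
          - (columnSum r * entry (incident E p i)) ∎
          where
          i = proj₁ (remQuot {k} l z)
          w = proj₂ (remQuot {k} l z)
          own : ∀ j → S.sum (λ v → - entry (incident E p j) * copies k Y (j , v) (i , w))
                    ≈ (if does (j ≟ i) then - (columnSum r * entry (incident E p j)) else 0#)
          own j with j ≟ i
          ... | yes _ = row*Y (entry (incident E p j)) w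
          ... | no  _ = T.sum-ε {l} λ v → R.zeroʳ (- entry (incident E p j))

        base≢pocket : ∀ p z → p ↑ˡ (k ℕ.* l) ≢ n ↑ʳ z
        base≢pocket p z eq
          with () ← trans (sym (splitAt-join n (k ℕ.* l) (inj₁ p)))
                          (trans (cong (splitAt n) eq) (splitAt-join n (k ℕ.* l) (inj₂ z)))

        base~pocket : ∀ p z → adj G (p ↑ˡ (k ℕ.* l)) (n ↑ʳ z) ≡ incident E p (proj₁ (remQuot {k} l z))
        base~pocket p z = trans (adj-join E (inj₁ p) (inj₂ z)) (attached≡incident E p _ _)

        pocketAdj : Fin (k ℕ.* l) → Fin (k ℕ.* l) → Bool
        pocketAdj y z = adjV (inj₂ (remQuot l y)) (inj₂ (remQuot l z))

        pocket-block : ∀ y z → χ′ (const (2 ℕ.+ r)) pocketAdj y z ≈ W y z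
        pocket-block y z = R.trans
          (R.reflexive (cong₂ (λ a m → a + μ (m ℕ.+ bit (pocketAdj y z)))
            (diagonal-remQuot {k = k} {l} y z) (diagonal-remQuot {k = k} {l} y z)))
          same-pocket
          where
          i = proj₁ (remQuot {k} l y)
          j = proj₁ (remQuot {k} l z)
          w = proj₂ (remQuot {k} l y)
          v = proj₂ (remQuot {k} l z)
          same-pocket : (if does (i ≟ j) then diagonal 0# (const x) w v else 0#)
                      + μ ((if does (i ≟ j) then diagonal 0 (const (2 ℕ.+ r)) w v else 0)
                           ℕ.+ bit (does (i ≟ j) ∧ adj (removeEnds e) w v))
                      ≈ copies k Y (i , w) (j , v)
          same-pocket with i ≟ j
          ... | yes _ = R.refl
          -- Between different copies the entry is `0# + μ 0`, which vanishes by the first half of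
          -- additivity.
          ... | no  _ = R.trans (R.+-identityˡ _) (proj₁ μ-additive)

        entries : ∀ s t → χ G (join n (k ℕ.* l) s) (join n (k ℕ.* l) t) ≈ bordered A B C W s t
        entries (inj₁ p) (inj₁ q) = R.reflexive (χ-restrict G (_↑ˡ (k ℕ.* l)) (↑ˡ-injective (k ℕ.* l) _ _)
          (degree-base E) (λ p q → adj-join E (inj₁ p) (inj₁ q)) p q)
        entries (inj₁ p) (inj₂ z) = R.reflexive (χ-≢ G (base≢pocket p z) (base~pocket p z))
        entries (inj₂ z) (inj₁ q) = R.reflexive (χ-≢ G (base≢pocket q z ∘ sym) (trans (adj-sym G _ _) (base~pocket q z)))
        entries (inj₂ y) (inj₂ z) = R.trans
          (R.reflexive (χ-restrict G (n ↑ʳ_) (↑ʳ-injective n _ _)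
            (degree-pocket E) (λ y z → adj-join E (inj₂ y) (inj₂ z)) y z))
          (pocket-block y z)

-- From the characteristic polynomial of the cone to that of the pasted graph

module Cospectrality {c ℓ₁ ℓ₂} (K : AlgebraicallyClosedField c ℓ₁ ℓ₂) where
  open AlgebraicallyClosedField K using (commutativeRing; rawRing; _×ᴷ_)
  open CommutativeRing commutativeRing using (Carrier; 1#)
  open Polynomial rawRing
  open PolynomialProperties commutativeRing
  open Splitting K using (monic-splits)
  open Spectrum K
  private
    module F = CommutativeRing commutativeRing
    module P = CommutativeRing polyCommutativeRing
  open P using (_≈_; _*_; _+_; -_; 0#)
  open Determinant polyRing
  open RawSemiringDefs (RawRing.rawSemiring polyRing) using (_^_; sum)
  open SemiringExp P.semiring using (^-congˡ)
  open DeterminantProperties polyCommutativeRing using (Block; flatten; eliminator; scalar; _⊗_)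

  -- Chosen so that `charpoly (Q G)` unfolds to `det (χ G)`; the two are used interchangeably below.
  μ : ℕ → Poly
  μ n = - constant (n ×ᴷ 1#)

  μ-0 : μ 0 ≈ 0#
  μ-0 zero    = RingProperties.-0#≈0# F.ring
  μ-0 (suc i) = F.refl

  μ-+ : ∀ a b → μ (a ℕ.+ b) ≈ μ a + μ b
  μ-+ a b zero = F.trans (F.-‿cong (MonoidMult.×-homo-+ F.+-monoid 1# a b))
                         (F.sym (RingProperties.-‿+-comm F.ring _ _))
  μ-+ a b (suc i) = F.refl

  degree≤-μ : ∀ n → Degree≤ 0 (μ n)
  degree≤-μ n = degree≤-neg {p = constant (n ×ᴷ 1#)} (degree≤-constant (n ×ᴷ 1#))

  monic-X+μ : ∀ n → Monic 1 (X + μ n)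
  monic-X+μ n = monic-+ monic-X (degree≤-μ n)

  open CharacteristicMatrix polyCommutativeRing X μ (μ-0 , μ-+)

  monic-χ′ : ∀ {n} d (a : Fin n → Fin n → Bool) p → Monic 1 (χ′ d a p p)
  monic-χ′ d a p rewrite diagonal-≡ {z = []} (const X) p = monic-X+μ (diagonal 0 d p p ℕ.+ bit (a p p))

  degree≤-χ′ : ∀ {n} d (a : Fin n → Fin n → Bool) p q → p ≢ q → Degree≤ 0 (χ′ d a p q)
  degree≤-χ′ d a p q p≢q rewrite diagonal-≢ {z = []} (const X) p≢q =
    degree≤-μ (diagonal 0 d p q ℕ.+ bit (a p q))

  degree≤-entry : ∀ b → Degree≤ 0 (entry b)
  degree≤-entry b = degree≤-μ (bit b)

  monic-columnSum : ∀ r → Monic 1 (columnSum r)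
  monic-columnSum r = monic-X+μ (2 ℕ.+ r ℕ.+ r)

  charpoly-monic : ∀ {n} (G : Graph n) → Monic (n ℕ.* 1) (det (χ G))
  charpoly-monic G = monic-det (monic-χ′ (degree G) (adj G)) (degree≤-χ′ (degree G) (adj G))

  monic-scalar : ∀ {d n t} → Monic (suc d) t → Monic (n ℕ.* suc d) (det (scalar {n} t))
  monic-scalar {d} {n} {t} mt = monic-det {d} {n} {scalar t}
    (λ p → ≡.subst (Monic (suc d)) (≡.sym (diagonal-≡ (const t) p)) mt)
    (λ p q p≢q → ≡.subst (Degree≤ d) (≡.sym (diagonal-≢ (const t) p≢q)) degree≤-[])

  monic-eliminator : ∀ {d a b t} {J : Fin a → Fin b → Poly} → Monic (suc d) t →
                     (∀ p w → Degree≤ d (J p w)) →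
                     Monic ((a ℕ.+ b) ℕ.* suc d) (det (flatten (eliminator t J)))
  monic-eliminator {d} {a} {b} {t} {J} mt dJ = monic-det
    (λ i → on-diagonal (splitAt a i))
    (λ i j i≢j → off-diagonal (splitAt a i) (splitAt a j) λ eq → i≢j
      (≡.trans (≡.sym (join-splitAt a b i)) (≡.trans (≡.cong (join a b) eq) (join-splitAt a b j))))
    where
    on-diagonal : ∀ s → Monic (suc d) (eliminator t J s s)
    on-diagonal (inj₁ p) = ≡.subst (Monic (suc d)) (≡.sym (diagonal-≡ (const t) p)) mt
    on-diagonal (inj₂ w) = ≡.subst (Monic (suc d)) (≡.sym (diagonal-≡ (const t) w)) mt

    off-diagonal : ∀ s u → s ≢ u → Degree≤ d (eliminator t J s u)
    off-diagonal (inj₁ p) (inj₁ q) s≢u =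
      ≡.subst (Degree≤ d) (≡.sym (diagonal-≢ (const t) (s≢u ∘ ≡.cong inj₁))) degree≤-[]
    off-diagonal (inj₁ p) (inj₂ w) s≢u = dJ p w
    off-diagonal (inj₂ w) (inj₁ q) s≢u = degree≤-[]
    off-diagonal (inj₂ w) (inj₂ v) s≢u =
      ≡.subst (Degree≤ d) (≡.sym (diagonal-≢ (const t) (s≢u ∘ ≡.cong inj₂))) degree≤-[]

  -- A diagonal entry is a product of two monic linear polynomials plus a constant, and an
  -- off-diagonal entry has degree at most one. Two rows of degree two give the degree 4.
  monic-coneSchur : ∀ l r → Monic 4 (det (coneSchur l r))
  monic-coneSchur l r = monic-det {1} {2} {coneSchur l r}
    (λ p → monic-+ {p = columnSum r * A p p} {B⊗C}
      (monic-* {p = columnSum r} {A p p} (monic-columnSum r) (monic-χ′ (const (suc l)) distinct p)) degree≤-B⊗C)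
    (λ p q p≢q → degree≤-+ {p = columnSum r * A p q} {B⊗C}
      (degree≤-* (columnSum r) {A p q} (degree≤ (monic-columnSum r)) (degree≤-χ′ (const (suc l)) distinct p q p≢q))
      degree≤-B⊗C)
    where
    distinct : Fin 2 → Fin 2 → Bool
    distinct p q = not (does (p ≟ q))

    A : Matrix Poly 2
    A = χ′ (const (suc l)) distinct

    B⊗C : Poly
    B⊗C = sum λ (_ : Fin l) → - entry true * entry true

    degree≤-B⊗C : Degree≤ 1 B⊗C
    degree≤-B⊗C = degree≤-mono z≤n (degree≤-sum λ (_ : Fin l) →
      degree≤-* (- entry true) (degree≤-neg {p = entry true} (degree≤-entry true)) (degree≤-entry true))

  module _ {l r} {H H′ : Graph (2 ℕ.+ l)} (e : Edge H) (e′ : Edge H′)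
           (src-dominating  : degree H (src e) ≡ suc l)   (tgt-dominating  : degree H (tgt e) ≡ suc l)
           (src-dominating′ : degree H′ (src e′) ≡ suc l) (tgt-dominating′ : degree H′ (tgt e′) ≡ suc l)
           (regular : Regular (removeEnds e) r) (regular′ : Regular (removeEnds e′) r)
           (φH≈φH′ : charpoly (Q H) ≈ charpoly (Q H′)) where
    private
      module C  = ConeDeterminants e src-dominating tgt-dominating regular
      module C′ = ConeDeterminants e′ src-dominating′ tgt-dominating′ regular′
    open SetoidReasoning P.setoid

    det-interior : det C.Y ≈ det C′.Y
    det-interior =
      monic-cancelˡ (monic-scalar {n = l} (monic-columnSum r)) (det C.Y) (det C′.Y)
        (monic-cancelˡ (monic-coneSchur l r) (det (scalar {l} (columnSum r)) * det C.Y) (det (scalar {l} (columnSum r)) * det C′.Y) (begin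
          det (coneSchur l r) * (det (scalar {l} (columnSum r)) * det C.Y)
            ≈⟨ C.det-cone ⟨
          det (flatten (coneEliminator l r)) * det (χ H)
            ≈⟨ *ᴾ-congˡ (det (flatten (coneEliminator l r))) (det (χ H)) (det (χ H′)) φH≈φH′ ⟩
          det (flatten (coneEliminator l r)) * det (χ H′)
            ≈⟨ C′.det-cone ⟩
          det (coneSchur l r) * (det (scalar {l} (columnSum r)) * det C′.Y) ∎))

    charpoly-pocket : ∀ {n k} {F : Graph n} (E : Fin k → Edge F) →
                      charpoly (Q (pocketGraph E e)) ≈ charpoly (Q (pocketGraph E e′))
    charpoly-pocket {k = k} E =
      monic-cancelˡ (monic-eliminator (monic-columnSum r) λ p z → degree≤-neg {p = junction E {l} p z}
         (degree≤-entry (incident E p (proj₁ (remQuot {k} l z)))))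
        (det (χ (pocketGraph E e))) (det (χ (pocketGraph E e′))) (begin
          det L * det (χ (pocketGraph E e))
            ≈⟨ C.det-pocket E ⟩
          det S * (det T * det C.Y ^ k)
            ≈⟨ *ᴾ-congˡ (det S) (det T * det C.Y ^ k) (det T * det C′.Y ^ k)
                 (*ᴾ-congˡ (det T) (det C.Y ^ k) (det C′.Y ^ k) (^-congˡ k {det C.Y} {det C′.Y} det-interior)) ⟩
          det S * (det T * det C′.Y ^ k)
            ≈⟨ C′.det-pocket E ⟨
          det L * det (χ (pocketGraph E e′)) ∎)
      where
      L = flatten (pocketEliminator E l r)
      S = pocketSchur E l r
      T = scalar {k ℕ.* l} (columnSum r)

  charpoly≈⇒QCospectral : ∀ {n} (G G′ : Graph n) → charpoly (Q G) ≈ charpoly (Q G′) → QCospectral G G′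
  charpoly≈⇒QCospectral G G′ φ≈φ′ with s , split ← monic-splits (charpoly-monic G) =
    s , split , λ i → F.trans (F.sym (φ≈φ′ i)) (split i)

corollary4p3 : ∀ {c ℓ₁ ℓ₂} (K : AlgebraicallyClosedField c ℓ₁ ℓ₂)
    {n k m r r₂ : ℕ} →
    2 ≤ n → 3 ≤ m → 2 ≤ r₂ →
    (F : Graph n) (E : Fin k → Edge F) →
    Injective _≡_ _≈ᵉ_ E →
    EdgeInducedRegular E r →
    (Huv Hxy : Graph m) (uv : Edge Huv) (xy : Edge Hxy) →
    degree Huv (src uv) ≡ m ∸ 1 → degree Huv (tgt uv) ≡ m ∸ 1 →
    degree Hxy (src xy) ≡ m ∸ 1 → degree Hxy (tgt xy) ≡ m ∸ 1 →
    Regular (removeEnds uv) r₂ →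
    Regular (removeEnds xy) r₂ →
    Spectrum.QCospectral K Huv Hxy →
    Spectrum.QCospectral K (pocketGraph E uv) (pocketGraph E xy)
-- Matching on `3 ≤ m` exposes two successors, so that `m ∸ 1` and `m ∸ 2` reduce. The spectrum
-- shared by `Huv` and `Hxy` is used only to equate their characteristic polynomials.
corollary4p3 K _ (s≤s (s≤s _)) _ F E _ _ Huv Hxy uv xy du dv dx dy regᵤᵥ regₓᵧ (_ , φuv , φxy) =
  charpoly≈⇒QCospectral (pocketGraph E uv) (pocketGraph E xy)
    (charpoly-pocket uv xy du dv dx dy regᵤᵥ regₓᵧ (λ i → F.trans (φuv i) (F.sym (φxy i))) E)
  where
  open Cospectrality K
  module F = CommutativeRing (AlgebraicallyClosedField.commutativeRing K)
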